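{- There is an absolute constant $C>0$ such that the following holds. Let $G=(V,E)$ be a connected, unweighted, undirected (multi-)graph with $|V|\ge2$, $m$ edges and min-cut value $\lambda$, and let $\mathcal T$ be a (nonempty) greedy tree-packing on $G$ with $|\mathcal T|\ge C\lambda^3\log m$. Then at least one of the following holds: 1. some $T\in\mathcal T$ $1$-respects a min-cut of $G$; or 2. some trivial cut in $G/\{e\in E:\ \ell^{\mathcal T}(e)<\tfrac{2}{\lambda}-\tfrac{1}{2\lambda^2}\}$ corresponds to a min-cut of $G$.
   Context: Multigraphs may have parallel edges but no self-loops. The min-cut value $\lambda$ is the minimum number of edges whose deletion disconnects $G$; a min-cut is a cut with exactly $\lambda$ edges. A tree-packing $\mathcal T$ of $G$ is a finite family of spanning trees of $G$; the load $L^{\mathcal T}(e)$ is the number of trees of $\mathcal T$ containing $e$; the relative load is $\ell^{\mathcal T}(e)=L^{\mathcal T}(e)/|\mathcal T|$. A tree-packing $(T_1,\dots,T_k)$ is greedy if each $T_{i+1}$ is a minimum weight spanning tree of $G$ with respect to the edge weights given by the number of trees among $T_1,\dots,T_i$ containing the edge (ties broken arbitrarily). A spanning tree $T$ $1$-respects a cut if at most one edge of $T$ crosses the cut. For $E'\subseteq E$, $G/E'$ is the graph obtained by contracting all edges in $E'$; its vertices are the vertex sets of the connected components of $(V,E')$. A trivial cut is a cut one side of which is a single vertex. A trivial cut of $G/E'$ around a vertex $X$ (with $X\neq V$) corresponds to the cut $(X,V\setminus X)$ of $G$. -}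

module Defs where

open import Data.Bool.Base using (_xor_)
open import Data.Fin.Base using (Fin)
open import Data.Fin.Subset using (Subset; _∈_; _∉_; _∩_; ∁; ∣_∣; ⊤; Nonempty)
open import Data.Fin.Subset.Properties using (_∈?_; x∈p⇒∣p-x∣<∣p∣)
open import Data.Integer.Base using (+_)
open import Data.List.Base as List using (List; []; _∷_; allFin; filter)
open import Data.List.Relation.Unary.Unique.Propositional using (Unique)
open import Data.Nat.Base using (ℕ; zero; suc; _≤_; _*_; _^_; NonZero; nonZero)
open import Data.Nat.Properties using (m*n≢0; m^n≢0; n≮0; ≤-reflexive; ≤-trans)
open import Data.Product.Base using (_×_; _,_; proj₁; proj₂; ∃-syntax)
open import Data.Rational.Base using (ℚ; _/_; _-_; _<_)
open import Data.Sum.Base using (_⊎_)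
open import Data.Vec.Base using (Vec; []; _∷_; count; lookup; tabulate)
open import Function.Bundles using (_⇔_)
open import Level using (0ℓ)
open import Relation.Binary.PropositionalEquality using (_≡_; _≢_)
open import Relation.Nullary.Negation using (¬_; contradiction)
open import Relation.Unary using (Pred; U; _⊆_)

-- Vertices are Fin n and edges are Fin m, so parallel edges are distinct
-- elements of Fin m.  The order of the two ends of an edge is immaterial:
-- everything below is invariant under swapping them.
record Multigraph (n m : ℕ) : Set where
  field
    end₁ end₂  : Fin m → Fin n
    noSelfLoop : ∀ e → end₁ e ≢ end₂ e

  Joins : Fin m → Fin n → Fin n → Set
  Joins e u v = (end₁ e ≡ u × end₂ e ≡ v) ⊎ (end₁ e ≡ v × end₂ e ≡ u)

  -- Walks using only edges of F.  The list records each step as the vertex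
  -- being left together with the edge taken.
  data Walk (F : Pred (Fin m) 0ℓ) : Fin n → List (Fin n × Fin m) → Fin n → Set where
    []  : ∀ {u} → Walk F u [] u
    _∷_ : ∀ {u v w e ss} → F e × Joins e u v → Walk F v ss w →
          Walk F u ((u , e) ∷ ss) w

  Reachable : Pred (Fin m) 0ℓ → Fin n → Fin n → Set
  Reachable F u v = ∃[ ss ] Walk F u ss v

  ConnectedVia : Pred (Fin m) 0ℓ → Set
  ConnectedVia F = ∀ u v → Reachable F u v

  Connected : Set
  Connected = ConnectedVia U

  -- Distinctness of the edges excludes traversing one edge back and forth,
  -- while two parallel edges do form a cycle.
  IsCycle : Pred (Fin m) 0ℓ → Fin n → List (Fin n × Fin m) → Set
  IsCycle F v ss =
    Walk F v ss v × ss ≢ [] ×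
    Unique (List.map proj₁ ss) × Unique (List.map proj₂ ss)

  Acyclic : Pred (Fin m) 0ℓ → Set
  Acyclic F = ∀ v ss → ¬ IsCycle F v ss

  IsSpanningTree : Subset m → Set
  IsSpanningTree T = ConnectedVia (_∈ T) × Acyclic (_∈ T)

  weight : (Fin m → ℕ) → Subset m → ℕ
  weight w T = List.sum (List.map w (filter (_∈? T) (allFin m)))

  IsMinimumSpanningTree : (Fin m → ℕ) → Subset m → Set
  IsMinimumSpanningTree w T =
    IsSpanningTree T × (∀ T′ → IsSpanningTree T′ → weight w T ≤ weight w T′)

  Disconnects : Subset m → Set
  Disconnects F = ¬ ConnectedVia (_∉ F)

  IsMinCutValue : ℕ → Set
  IsMinCutValue lam =
    (∃[ F ] (Disconnects F × ∣ F ∣ ≡ lam)) × (∀ F → Disconnects F → lam ≤ ∣ F ∣)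

  -- A cut is represented by one of its sides.
  IsCut : Subset n → Set
  IsCut S = Nonempty S × Nonempty (∁ S)

  crossing : Subset n → Subset m
  crossing S = tabulate λ e → lookup S (end₁ e) xor lookup S (end₂ e)

  -- lam is meant to be the min-cut value.
  IsMinCut : ℕ → Subset n → Set
  IsMinCut lam S = IsCut S × ∣ crossing S ∣ ≡ lam

  OneRespects : Subset m → Subset n → Set
  OneRespects T S = ∣ T ∩ crossing S ∣ ≤ 1

  -- A vertex of G/F: the vertex set of a connected component of (V, F).
  IsContractedVertex : Pred (Fin m) 0ℓ → Subset n → Set
  IsContractedVertex F X =
    Nonempty X × (∀ {u} → u ∈ X → ∀ v → v ∈ X ⇔ Reachable F u v)

  -- The trivial cut of G/F around its vertex X; the cut of G corresponding to
  -- it has X itself as a side.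
  IsTrivialCutOfContraction : Pred (Fin m) 0ℓ → Subset n → Set
  IsTrivialCutOfContraction F X = IsContractedVertex F X × X ≢ ⊤

  private
    mapWalk : ∀ {F F′ : Pred (Fin m) 0ℓ} → F ⊆ F′ →
              ∀ {u ss v} → Walk F u ss v → Walk F′ u ss v
    mapWalk f []             = []
    mapWalk f ((p , j) ∷ ws) = (f p , j) ∷ mapWalk f ws

  minCutValue-nonZero : Connected → ∀ {lam} → IsMinCutValue lam → NonZero lam
  minCutValue-nonZero conn {suc _} _ = nonZero
  minCutValue-nonZero conn {zero} ((F , disc , ∣F∣≡0) , _) =
    contradiction
      (λ u v → let ss , ws = conn u v in ss , mapWalk (λ {e} _ → none e) ws)
      disc
    where
    none : ∀ e → e ∉ F
    none e e∈F = n≮0 (≤-trans (x∈p⇒∣p-x∣<∣p∣ e∈F) (≤-reflexive ∣F∣≡0))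

load : ∀ {m k} → Vec (Subset m) k → Fin m → ℕ
load 𝒯 e = count (e ∈?_) 𝒯

relativeLoad : ∀ {m k} .{{_ : NonZero k}} → Vec (Subset m) k → Fin m → ℚ
relativeLoad {k = k} 𝒯 e = + load 𝒯 e / k

-- The most recently added tree comes first: the packing (T₁, …, Tₖ) is
-- represented by the vector Tₖ ∷ … ∷ T₁ ∷ [].
data IsGreedy {n m} (G : Multigraph n m) : ∀ {k} → Vec (Subset m) k → Set where
  []  : IsGreedy G []
  _∷_ : ∀ {k T} {𝒯 : Vec (Subset m) k} →
        Multigraph.IsMinimumSpanningTree G (load 𝒯) T →
        IsGreedy G 𝒯 → IsGreedy G (T ∷ 𝒯)

threshold : (lam : ℕ) .{{_ : NonZero lam}} → ℚ
threshold lam = (+ 2 / lam) - (+ 1 / (2 * lam ^ 2))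
  where instance
    _ : NonZero (2 * lam ^ 2)
    _ = m*n≢0 2 (lam ^ 2) {{_}} {{m^n≢0 lam 2}}

LowLoad : ∀ {m k} .{{_ : NonZero k}} → Vec (Subset m) k →
          (lam : ℕ) → .(NonZero lam) → Pred (Fin m) 0ℓ
LowLoad 𝒯 lam lam≢0 e = relativeLoad 𝒯 e < threshold lam {{lam≢0}}

-- a · log₂ m ≤ k as an inequality of real numbers (for m ≥ 1), exponentiated.
-- The base of the logarithm only matters up to a constant factor in a.
_·log₂_≤_ : ℕ → ℕ → ℕ → Set
a ·log₂ m ≤ k = m ^ a ≤ 2 ^ k

{-# OPTIONS --safe #-}
module Submission where

-- Suppose no tree 1-respects a min-cut, so every min-cut has total relative load at
-- least 2.  Let c count components and let D maximize ν c(B) + p |B| over edge sets B,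
-- where p / ν = 2/λ − 1/(4λ²).  Multiplicative-weight potentials show that, up to an error
-- O(1/λ²) with a small constant, greedy relative loads are at most 2/λ everywhere, at most
-- p / ν on D, and at least p / ν off D; each step only needs that a minimum spanning tree
-- restricted to the edges below any load level spans them.
--
-- If every component of D had at least λ + 1 outgoing edges, D would not be optimal, so
-- some component X has degree at most λ; it is not all of V, because then all loads
-- would be too small on a min-cut.  Hence X is a min-cut.  No min-cut Y lies strictly
-- inside X: at least λ/2 edges of Y run inside X, and their smaller loads would push the
-- total load of Y below 2.  Therefore every proper subset of X has degree at least
-- λ + 1, which bounds the relative loads inside X by about 2/(λ + 1), below the
-- threshold, while the edges leaving X are off D and above it.

open import Defs
open import Data.Bool.Base using (Bool; true; false; not; _∧_; _∨_; _xor_; if_then_else_)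
import Data.Bool.Properties as Bool
open import Data.Empty using (⊥)
open import Data.Fin.Base using (Fin; zero; suc)
import Data.Fin.Properties as Fin
open import Data.Fin.Subset using (Subset; ∣_∣; ∁; _∩_) renaming (_∈_ to _∈ˢ_)
open import Data.Fin.Subset.Properties using (anySubset?; nonempty?; x∉p⇒x∈∁p; ∈⊤) renaming (_∈?_ to _∈ˢ?_)
open import Data.Integer.Base as ℤ using (+<+)
import Data.Integer.Properties as ℤ
open import Data.Integer.Tactic.RingSolver using () renaming (solve-∀ to ℤ-solve-∀)
open import Data.List.Base as List using (List; []; _∷_; _++_; length; allFin; filter; map)
open import Data.List.Membership.DecPropositional using (_∈?_)
open import Data.List.Membership.Propositional using () renaming (_∈_ to _∈ˡ_; _∉_ to _∉ˡ_)
open import Data.List.Membership.Propositional.Properties using (∈-filter⁺; ∈-filter⁻; ∈-allFin; ∈-++⁺ˡ; ∈-++⁺ʳ; ∈-++⁻)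
open import Data.List.Properties using (filter-≐)
open import Data.List.Relation.Unary.All as All using (All; []; _∷_)
import Data.List.Relation.Unary.All.Properties as All
open import Data.List.Relation.Unary.AllPairs using ([]; _∷_)
open import Data.List.Relation.Unary.Any using (here; there)
open import Data.List.Relation.Unary.Unique.Propositional using (Unique)
import Data.List.Relation.Unary.Unique.Propositional.Properties as Unique
open import Data.Nat.Base
import Data.Nat.ListAction as ListAction
open import Data.Nat.Properties
open import Algebra.Properties.Semiring.Sum +-*-semiring using (sum; sum-cong-≗; ∑-distrib-+; ∑-comm; *-distribˡ-sum; *-distribʳ-sum)
open import Data.Nat.Tactic.RingSolver using (solve-∀)
open import Data.Product.Base using (_×_; _,_; proj₁; proj₂; ∃-syntax)
import Data.Rational.Base as ℚ
import Data.Rational.Properties as ℚ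
open import Data.Rational.Unnormalised.Base as ℚᵘ using (mkℚᵘ; *<*; _≃_)
import Data.Rational.Unnormalised.Properties as ℚᵘ
open import Data.Sum.Base using (_⊎_; inj₁; inj₂)
open import Data.Vec.Base as Vec using (Vec; lookup; tabulate; []; _∷_)
open import Data.Vec.Membership.Propositional using (_∈_; find)
open import Data.Vec.Properties using (count≤n; []=⇒lookup; lookup⇒[]=; lookup∘tabulate; lookup-zipWith)
open import Data.Vec.Relation.Unary.Any as VecAny using (here; there)
open import Function.Base using (_∘_; id; case_of_)
open import Function.Bundles using (Equivalence; mk⇔)
open import Level using (0ℓ)
open import Relation.Binary.PropositionalEquality using (_≡_; _≢_; refl; sym; trans; cong; cong₂; subst; subst₂; module ≡-Reasoning)
open import Relation.Nullary.Decidable using (dec-true; dec-false; decidable-stable)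
open import Relation.Nullary.Decidable.Core using (Dec; yes; no; does; _×-dec_)
open import Relation.Nullary.Negation using (¬_; contradiction)
open import Relation.Unary using (Pred)

-- Finite sums

-- The ideal loads are never constructed: at each critical load `p / ν`, optimality of an edge set
-- gives a linear inequality that every greedy tree obeys on each load level, and a potential turns
-- it into a bound on single loads. An edge is weighted by `(1 + 1/N) ^ (ν * load)`, or by the
-- inverse for lower bounds, with denominators cleared.
--
-- Two units of `1/ν` are lost. One pays for replacing the exponential curve by its chord, which
-- needs `N` of order `p * ν`; the other pays for the initial potential, which can be as large as
-- `m`, and needs `N * log₂ m ≤ k`. Separating loads near 2/λ at distance 1/λ² takes `ν` of order λ²
-- and `p` of order λ, so `N` is of order λ³: this is the origin of λ³ log m.
--
-- With `ν = 20 λ²` the threshold lies ten units below 2/λ and the critical load of D five units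
-- below it, so errors of two units on either side do no harm.

𝟙 : Bool → ℕ
𝟙 true  = 1
𝟙 false = 0

𝟙≤1 : ∀ b → 𝟙 b ≤ 1
𝟙≤1 true  = ≤-refl
𝟙≤1 false = z≤n

𝟙-mono : ∀ {b c} → (b ≡ true → c ≡ true) → 𝟙 b ≤ 𝟙 c
𝟙-mono {false} f = z≤n
𝟙-mono {true}  f rewrite f refl = ≤-refl

sum-mono-≤ : ∀ {n} {f g : Fin n → ℕ} → (∀ i → f i ≤ g i) → sum f ≤ sum g
sum-mono-≤ {zero}  f≤g = z≤n
sum-mono-≤ {suc n} f≤g = +-mono-≤ (f≤g zero) (sum-mono-≤ (f≤g ∘ suc))

fi≤sum : ∀ {n} (f : Fin n → ℕ) i → f i ≤ sum f
fi≤sum f zero    = m≤m+n _ _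
fi≤sum f (suc i) = m≤n⇒m≤o+n (f zero) (fi≤sum (f ∘ suc) i)

sum-0 : ∀ n → sum {n} (λ _ → 0) ≡ 0
sum-0 zero    = refl
sum-0 (suc n) = sum-0 n

sum-const : ∀ n c → sum {n} (λ _ → c) ≡ n * c
sum-const zero    c = refl
sum-const (suc n) c = cong (c +_) (sum-const n c)

sum-δ : ∀ {n} (x : Fin n) (f : Fin n → ℕ) → sum (λ i → 𝟙 (does (x Fin.≟ i)) * f i) ≡ f x
sum-δ {suc n} zero    f = trans (cong₂ _+_ (*-identityˡ _) (sum-0 n)) (+-identityʳ _)
sum-δ {suc n} (suc x) f = sum-δ x (f ∘ suc)

sum-𝟙≤1 : ∀ {n} (P : Fin n → Bool) → (∀ i j → P i ≡ true → P j ≡ true → i ≡ j) →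
          sum (𝟙 ∘ P) ≤ 1
sum-𝟙≤1 {n} P unique with Fin.any? (λ i → P i Bool.≟ true)
... | no ¬P = ≤-trans (sum-mono-≤ {g = λ _ → 0} (λ i → 𝟙-mono {c = false} λ Pi → contradiction (i , Pi) ¬P))
                      (≤-trans (≤-reflexive (sum-0 n)) z≤n)
... | yes (x , Px) = begin
  sum (𝟙 ∘ P)                                ≤⟨ sum-mono-≤ le ⟩
  sum (λ i → 𝟙 (does (x Fin.≟ i)) * 1)       ≡⟨ sum-δ x (λ _ → 1) ⟩
  1                                          ∎
  where
  open ≤-Reasoning
  le : ∀ i → 𝟙 (P i) ≤ 𝟙 (does (x Fin.≟ i)) * 1
  le i = ≤-trans (𝟙-mono λ Pi → dec-true (x Fin.≟ i) (unique x i Px Pi)) (≤-reflexive (sym (*-identityʳ _)))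

∧-splits : ∀ {b c} → b ∧ c ≡ true → b ≡ true × c ≡ true
∧-splits {true} {true} _ = refl , refl

does⇒ : ∀ {n} (x y : Fin n) → does (x Fin.≟ y) ≡ true → x ≡ y
does⇒ x y h with x Fin.≟ y
... | yes p = p

sum-𝟙-injection : ∀ {m n} (P : Fin m → Bool) (Q : Fin n → Bool) (φ : Fin m → Fin n) →
                  (∀ i → P i ≡ true → Q (φ i) ≡ true) →
                  (∀ i j → P i ≡ true → P j ≡ true → φ i ≡ φ j → i ≡ j) →
                  sum (𝟙 ∘ P) ≤ sum (𝟙 ∘ Q)
sum-𝟙-injection {m} P Q φ into inj = begin
  sum (𝟙 ∘ P)                                ≡⟨ sum-cong-≗ (λ i → sym (sum-δ (φ i) (λ _ → 𝟙 (P i)))) ⟩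
  sum (λ i → sum λ j → δ i j * 𝟙 (P i))      ≡⟨ ∑-comm (λ i j → δ i j * 𝟙 (P i)) ⟩
  sum (λ j → sum λ i → δ i j * 𝟙 (P i))      ≤⟨ sum-mono-≤ fibre ⟩
  sum (𝟙 ∘ Q)                                ∎
  where
  open ≤-Reasoning
  δ : _ → _ → ℕ
  δ i j = 𝟙 (does (φ i Fin.≟ j))
  𝟙-∧ : ∀ b c → 𝟙 b * 𝟙 c ≡ 𝟙 (b ∧ c)
  𝟙-∧ true  c = *-identityˡ _
  𝟙-∧ false c = refl
  fibre : ∀ j → sum (λ i → δ i j * 𝟙 (P i)) ≤ 𝟙 (Q j)
  fibre j with Q j in Qj
  ... | true = ≤-trans (≤-reflexive (sum-cong-≗ λ i → 𝟙-∧ (does (φ i Fin.≟ j)) (P i)))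
                       (sum-𝟙≤1 _ λ i i′ p p′ → let a , b = ∧-splits p ; c , d = ∧-splits p′ in
                          inj i i′ b d (trans (does⇒ (φ i) j a) (sym (does⇒ (φ i′) j c))))
  ... | false = ≤-trans (sum-mono-≤ {g = λ _ → 0} none) (≤-reflexive (sum-0 m))
    where
    none : ∀ i → δ i j * 𝟙 (P i) ≤ 0
    none i with φ i Fin.≟ j | P i in Pi
    ... | no  _    | _     = z≤n
    ... | yes refl | false = z≤n
    ... | yes refl | true  = contradiction (trans (sym (into i Pi)) Qj) λ ()

-- A nonnegative integer W is the number of thresholds t with t < W, so a weighted
-- inequality follows from its restrictions to the superlevel sets of the weight.
layer-cake : ∀ {m} (W a b : Fin m → ℕ) →
             (∀ t → sum (λ e → 𝟙 (t <ᵇ W e) * a e) ≤ sum (λ e → 𝟙 (t <ᵇ W e) * b e)) →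
             sum (λ e → W e * a e) ≤ sum (λ e → W e * b e)
layer-cake W a b level = subst₂ _≤_ (untrunc a) (untrunc b) (truncated (sum W))
  where
  open ≤-Reasoning
  ⊓-suc : ∀ w K → w ⊓ suc K ≡ w ⊓ K + 𝟙 (K <ᵇ w)
  ⊓-suc zero    K       = refl
  ⊓-suc (suc w) zero    = cong suc (⊓-zeroʳ w)
  ⊓-suc (suc w) (suc K) = cong suc (⊓-suc w K)
  split : ∀ K (f : _ → ℕ) → sum (λ e → (W e ⊓ suc K) * f e) ≡
          sum (λ e → (W e ⊓ K) * f e) + sum (λ e → 𝟙 (K <ᵇ W e) * f e)
  split K f = trans (sum-cong-≗ λ e → trans (cong (_* f e) (⊓-suc (W e) K)) (*-distribʳ-+ (f e) (W e ⊓ K) _))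
                    (∑-distrib-+ (λ e → (W e ⊓ K) * f e) (λ e → 𝟙 (K <ᵇ W e) * f e))
  truncated : ∀ K → sum (λ e → (W e ⊓ K) * a e) ≤ sum (λ e → (W e ⊓ K) * b e)
  truncated zero = ≤-reflexive (sum-cong-≗ λ e → trans (cong (_* a e) (⊓-zeroʳ (W e))) (cong (_* b e) (sym (⊓-zeroʳ (W e)))))
  truncated (suc K) = subst₂ _≤_ (sym (split K a)) (sym (split K b)) (+-mono-≤ (truncated K) (level K))
  untrunc : ∀ f → sum (λ e → (W e ⊓ sum W) * f e) ≡ sum (λ e → W e * f e)
  untrunc f = sum-cong-≗ λ e → cong (_* f e) (m≤n⇒m⊓n≡m (fi≤sum W e))

-- Exponential inequalities

^-*-distrib : ∀ a b k → (a * b) ^ k ≡ a ^ k * b ^ k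
^-*-distrib a b zero    = refl
^-*-distrib a b (suc k) = trans (cong (a * b *_) (^-*-distrib a b k)) (solve-4 a b (a ^ k) (b ^ k))
  where
  solve-4 : ∀ a b x y → a * b * (x * y) ≡ a * x * (b * y)
  solve-4 = solve-∀

^-split : ∀ a {j n} → j ≤ n → a ^ n ≡ a ^ j * a ^ (n ∸ j)
^-split a {j} {n} j≤n = trans (cong (a ^_) (sym (m+[n∸m]≡n j≤n))) (^-distribˡ-+-* a j (n ∸ j))

-- Bernoulli's inequality `(1 + 1/N) ^ j ≥ 1 + j/N`, with denominators cleared.
bernoulli : ∀ N j → (N + j) * N ^ j ≤ N * suc N ^ j
bernoulli N zero    = ≤-reflexive (cong (_* 1) (+-identityʳ N))
bernoulli N (suc j) = begin
  (N + suc j) * (N * N ^ j)                   ≤⟨ m≤m+n _ (j * N ^ j) ⟩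
  (N + suc j) * (N * N ^ j) + j * N ^ j       ≡⟨ eq N j (N ^ j) ⟩
  suc N * ((N + j) * N ^ j)                   ≤⟨ *-monoʳ-≤ (suc N) (bernoulli N j) ⟩
  suc N * (N * suc N ^ j)                     ≡⟨ eq′ N (suc N ^ j) ⟩
  N * (suc N * suc N ^ j)                     ∎
  where
  open ≤-Reasoning
  eq : ∀ N j x → (N + suc j) * (N * x) + j * x ≡ suc N * ((N + j) * x)
  eq N j x = trans (lhs N j x) (sym (rhs N j x))
    where
    lhs : ∀ N j x → (N + (1 + j)) * (N * x) + j * x ≡ N * N * x + N * x + N * j * x + j * x
    lhs = solve-∀
    rhs : ∀ N j x → (1 + N) * ((N + j) * x) ≡ N * N * x + N * x + N * j * x + j * x
    rhs = solve-∀
  eq′ : ∀ N x → suc N * (N * x) ≡ N * (suc N * x)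
  eq′ N x = trans (sym (*-assoc (suc N) N x)) (trans (cong (_* x) (*-comm (suc N) N)) (*-assoc N (suc N) x))

-- Bernoulli's inequality at `-1/(N+1)`, namely `(1 - 1/(N+1)) ^ j ≥ 1 - j/(N+1)`, with denominators
-- cleared and the negative term moved across.
bernoulli′ : ∀ N j → suc N * suc N ^ j ≤ suc N * N ^ j + j * suc N ^ j
bernoulli′ N zero    = ≤-reflexive (sym (+-identityʳ _))
bernoulli′ N (suc j) = begin
  a * (a * a ^ j)                              ≤⟨ *-monoʳ-≤ a (bernoulli′ N j) ⟩
  a * (a * N ^ j + j * a ^ j)                  ≡⟨ eq N j (N ^ j) (a ^ j) ⟩
  a * (N * N ^ j) + j * (a * a ^ j) + a * N ^ j ≤⟨ +-monoʳ-≤ (a * (N * N ^ j) + j * (a * a ^ j)) (*-monoʳ-≤ a (^-monoˡ-≤ j (n≤1+n N))) ⟩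
  a * (N * N ^ j) + j * (a * a ^ j) + a * a ^ j ≡⟨ eq′ (a * (N * N ^ j)) (a * a ^ j) j ⟩
  a * (N * N ^ j) + suc j * (a * a ^ j)        ∎
  where
  open ≤-Reasoning
  a = suc N
  eq : ∀ N j x y → suc N * (suc N * x + j * y) ≡ suc N * (N * x) + j * (suc N * y) + suc N * x
  eq = solve-∀
  eq′ : ∀ u v j → u + j * v + v ≡ u + suc j * v
  eq′ = solve-∀

-- The exponential curve j ↦ N ^ (n ∸ j) * (N + 1) ^ j is so flat for n much smaller
-- than N that at p + 1 it lies above its chord over [0, n] taken at p.
chord≤curve : ∀ {N n p δ} .{{_ : NonZero N}} → suc p ≤ n → suc p * n ≤ N → suc N ^ n ≡ N ^ n + δ →
              n * N ^ n + p * δ ≤ n * (N ^ (n ∸ suc p) * suc N ^ suc p)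
chord≤curve {N} {n} {p} {δ} b≤n bn≤N X≡Y+δ = *-cancelˡ-≤ N (begin
  N * (n * Y + p * δ)                ≡⟨ eq₁ N n Y p δ ⟩
  n * N * Y + p * N * δ              ≤⟨ +-monoʳ-≤ (n * N * Y) pNδ≤bnY ⟩
  n * N * Y + b * n * Y              ≡⟨ eq₂ N n b Y ⟩
  n * ((N + b) * Y)                  ≤⟨ *-monoʳ-≤ n at-b ⟩
  n * (N * (N ^ (n ∸ b) * a ^ b))    ≡⟨ eq₃ n N _ ⟩
  N * (n * (N ^ (n ∸ b) * a ^ b))    ∎)
  where
  open ≤-Reasoning
  b a Y : ℕ
  b = suc p
  a = suc N
  Y = N ^ n
  eq₁ : ∀ N n Y p δ → N * (n * Y + p * δ) ≡ n * N * Y + p * N * δ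
  eq₁ = solve-∀
  eq₂ : ∀ N n b Y → n * N * Y + b * n * Y ≡ n * ((N + b) * Y)
  eq₂ = solve-∀
  eq₃ : ∀ n N x → n * (N * x) ≡ N * (n * x)
  eq₃ = solve-∀
  eq₄ : ∀ N b x y → (N + b) * (x * y) ≡ y * ((N + b) * x)
  eq₄ = solve-∀
  eq₅ : ∀ N x y → x * (N * y) ≡ N * (x * y)
  eq₅ = solve-∀
  at-b : (N + b) * Y ≤ N * (N ^ (n ∸ b) * a ^ b)
  at-b = begin
    (N + b) * Y                        ≡⟨ cong ((N + b) *_) (^-split N b≤n) ⟩
    (N + b) * (N ^ b * N ^ (n ∸ b))    ≡⟨ eq₄ N b (N ^ b) _ ⟩
    N ^ (n ∸ b) * ((N + b) * N ^ b)    ≤⟨ *-monoʳ-≤ (N ^ (n ∸ b)) (bernoulli N b) ⟩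
    N ^ (n ∸ b) * (N * a ^ b)          ≡⟨ eq₅ N (N ^ (n ∸ b)) (a ^ b) ⟩
    N * (N ^ (n ∸ b) * a ^ b)          ∎
  aδ≤ : a * δ ≤ n * Y + n * δ
  aδ≤ = +-cancelˡ-≤ (a * Y) _ _ (begin
    a * Y + a * δ                      ≡⟨ sym (*-distribˡ-+ a Y δ) ⟩
    a * (Y + δ)                        ≡⟨ cong (a *_) (sym X≡Y+δ) ⟩
    a * a ^ n                          ≤⟨ bernoulli′ N n ⟩
    a * Y + n * a ^ n                  ≡⟨ cong (λ x → a * Y + n * x) X≡Y+δ ⟩
    a * Y + n * (Y + δ)                ≡⟨ cong (a * Y +_) (*-distribˡ-+ n Y δ) ⟩
    a * Y + (n * Y + n * δ)            ∎)
  eq₆ : ∀ N p δ → p * N * δ + (N * δ + suc p * δ) ≡ suc p * (suc N * δ)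
  eq₆ = solve-∀
  eq₇ : ∀ b n Y δ → b * (n * Y + n * δ) ≡ b * n * Y + b * n * δ
  eq₇ = solve-∀
  -- `aδ≤` bounds `δ` by about `n * Y / N`. Its second-order error `b * n * δ` is at most `N * δ`,
  -- exactly what lowering the factor from `b` to `p` saves.
  pNδ≤bnY : p * N * δ ≤ b * n * Y
  pNδ≤bnY = +-cancelʳ-≤ (N * δ) _ _ (begin
    p * N * δ + N * δ                  ≤⟨ +-monoʳ-≤ (p * N * δ) (m≤m+n (N * δ) (b * δ)) ⟩
    p * N * δ + (N * δ + b * δ)        ≡⟨ eq₆ N p δ ⟩
    b * (a * δ)                        ≤⟨ *-monoʳ-≤ b aδ≤ ⟩
    b * (n * Y + n * δ)                ≡⟨ eq₇ b n Y δ ⟩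
    b * n * Y + b * n * δ              ≤⟨ +-monoʳ-≤ (b * n * Y) (*-monoˡ-≤ δ bn≤N) ⟩
    b * n * Y + N * δ                  ∎)

-- The same for the decreasing curve j ↦ N ^ j * (N + 1) ^ (n ∸ j), with p = j + 1.
chord≤curve′ : ∀ {N n j δ} → j ≤ n → j * n ≤ N → suc N ^ n ≡ N ^ n + δ →
               n * suc N ^ n ≤ n * (N ^ j * suc N ^ (n ∸ j)) + suc j * δ
chord≤curve′ {N} {n} {j} {δ} j≤n jn≤N Y≡X+δ = *-cancelˡ-≤ a (begin
  a * (n * Y)                                 ≡⟨ eq₁ a n Y ⟩
  n * (a * Y)                                 ≤⟨ *-monoʳ-≤ n at-j ⟩
  n * (a * h + j * Y)                         ≡⟨ eq₂ n a h j Y ⟩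
  a * (n * h) + j * (n * Y)                   ≤⟨ +-monoʳ-≤ (a * (n * h)) (*-monoʳ-≤ j nY≤) ⟩
  a * (n * h) + j * ((N + n) * δ)             ≡⟨ eq₃ (a * (n * h)) j N n δ ⟩
  -- The second-order term `j * n * δ` costs at most one more `N * δ`; this is why the chord is
  -- taken at `suc j` and the curve at `j`.
  a * (n * h) + (j * N * δ + j * n * δ)       ≤⟨ +-monoʳ-≤ (a * (n * h)) (+-monoʳ-≤ (j * N * δ) (*-monoˡ-≤ δ jn≤N)) ⟩
  a * (n * h) + (j * N * δ + N * δ)           ≤⟨ m≤m+n _ (suc j * δ) ⟩
  a * (n * h) + (j * N * δ + N * δ) + suc j * δ  ≡⟨ eq₄ N (n * h) j δ ⟩
  a * (n * h + suc j * δ)                     ∎)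
  where
  open ≤-Reasoning
  a X Y h : ℕ
  a = suc N
  X = N ^ n
  Y = suc N ^ n
  h = N ^ j * suc N ^ (n ∸ j)
  eq₁ : ∀ a n Y → a * (n * Y) ≡ n * (a * Y)
  eq₁ = solve-∀
  eq₂ : ∀ n a h j Y → n * (a * h + j * Y) ≡ a * (n * h) + j * (n * Y)
  eq₂ = solve-∀
  eq₃ : ∀ x j N n δ → x + j * ((N + n) * δ) ≡ x + (j * N * δ + j * n * δ)
  eq₃ = solve-∀
  eq₄ : ∀ N y j δ → suc N * y + (j * N * δ + N * δ) + suc j * δ ≡ suc N * (y + suc j * δ)
  eq₄ = solve-∀
  eq₅ : ∀ a x y → a * (x * y) ≡ a * x * y
  eq₅ = solve-∀
  eq₆ : ∀ a u j v y → (a * u + j * v) * y ≡ a * (u * y) + j * (v * y)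
  eq₆ = solve-∀
  at-j : a * Y ≤ a * h + j * Y
  at-j = begin
    a * Y                                     ≡⟨ cong (a *_) (^-split a j≤n) ⟩
    a * (a ^ j * a ^ (n ∸ j))                 ≡⟨ eq₅ a (a ^ j) (a ^ (n ∸ j)) ⟩
    a * a ^ j * a ^ (n ∸ j)                   ≤⟨ *-monoˡ-≤ (a ^ (n ∸ j)) (bernoulli′ N j) ⟩
    (a * N ^ j + j * a ^ j) * a ^ (n ∸ j)     ≡⟨ eq₆ a (N ^ j) j _ _ ⟩
    a * h + j * (a ^ j * a ^ (n ∸ j))         ≡⟨ cong (λ x → a * h + j * x) (sym (^-split a j≤n)) ⟩
    a * h + j * Y                             ∎
  nX≤Nδ : n * X ≤ N * δ
  nX≤Nδ = +-cancelˡ-≤ (N * X) _ _ (begin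
    N * X + n * X        ≡⟨ sym (*-distribʳ-+ X N n) ⟩
    (N + n) * X          ≤⟨ bernoulli N n ⟩
    N * Y                ≡⟨ cong (N *_) Y≡X+δ ⟩
    N * (X + δ)          ≡⟨ *-distribˡ-+ N X δ ⟩
    N * X + N * δ        ∎)
  nY≤ : n * Y ≤ (N + n) * δ
  nY≤ = begin
    n * Y                ≡⟨ cong (n *_) Y≡X+δ ⟩
    n * (X + δ)          ≡⟨ *-distribˡ-+ n X δ ⟩
    n * X + n * δ        ≤⟨ +-monoˡ-≤ (n * δ) nX≤Nδ ⟩
    N * δ + n * δ        ≡⟨ sym (*-distribʳ-+ δ N n) ⟩
    (N + n) * δ          ∎

-- Since `2 ≤ (1 + 1/N) ^ N`, the hypotheses give `(1 + 1/N) ^ (d * N) ≤ m ^ N ≤ 2 ^ k ≤ (1 + 1/N) ^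
-- (k * N)`, and exponents can be compared without real logarithms.
logarithmic-excess : ∀ {N d k m} .{{_ : NonZero N}} → suc N ^ d ≤ m * N ^ d → m ^ N ≤ 2 ^ k → d ≤ k
logarithmic-excess {N} {d} {k} {m} h mN≤2k = ≮⇒≥ λ k<d →
  let s , k+1+s≡d = m≤n⇒∃[o]m+o≡n k<d
  in contradiction (tooSmall (suc s) (trans (+-suc k s) k+1+s≡d))
       (<⇒≱ (^-monoˡ-< (suc s) B<A))
  where
  open ≤-Reasoning
  A B : ℕ
  A = suc N ^ N
  B = N ^ N
  instance
    B≢0 : NonZero B
    B≢0 = m^n≢0 N N
    A≢0 : NonZero A
    A≢0 = m^n≢0 (suc N) N
  2B≤A : 2 * B ≤ A
  2B≤A = *-cancelˡ-≤ N (≤-trans (≤-reflexive (eq N B)) (bernoulli N N))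
    where
    eq : ∀ N B → N * (2 * B) ≡ (N + N) * B
    eq = solve-∀
  B<A : B < A
  B<A = <-≤-trans (subst (B <_) (eq B) (m<m+n B (>-nonZero⁻¹ B))) 2B≤A
    where
    eq : ∀ B → B + B ≡ 2 * B
    eq = solve-∀
  swap^ : ∀ a → (a ^ d) ^ N ≡ (a ^ N) ^ d
  swap^ a = trans (^-*-assoc a d N) (trans (cong (a ^_) (*-comm d N)) (sym (^-*-assoc a N d)))
  Ad≤ : A ^ d ≤ 2 ^ k * B ^ d
  Ad≤ = begin
    A ^ d                ≡⟨ sym (swap^ (suc N)) ⟩
    (suc N ^ d) ^ N      ≤⟨ ^-monoˡ-≤ N h ⟩
    (m * N ^ d) ^ N      ≡⟨ ^-*-distrib m (N ^ d) N ⟩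
    m ^ N * (N ^ d) ^ N  ≡⟨ cong (m ^ N *_) (swap^ N) ⟩
    m ^ N * B ^ d        ≤⟨ *-monoˡ-≤ (B ^ d) mN≤2k ⟩
    2 ^ k * B ^ d        ∎
  tooSmall : ∀ s → k + s ≡ d → A ^ s ≤ B ^ s
  tooSmall s refl = *-cancelˡ-≤ (A ^ k * B ^ k) {{m*n≢0 (A ^ k) (B ^ k) {{m^n≢0 A k}} {{m^n≢0 B k}}}} (begin
    A ^ k * B ^ k * A ^ s              ≡⟨ eq (A ^ k) (B ^ k) (A ^ s) ⟩
    B ^ k * (A ^ k * A ^ s)            ≡⟨ cong (B ^ k *_) (sym (^-distribˡ-+-* A k s)) ⟩
    B ^ k * A ^ (k + s)                ≤⟨ *-monoʳ-≤ (B ^ k) Ad≤ ⟩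
    B ^ k * (2 ^ k * B ^ (k + s))      ≡⟨ eq′ (B ^ k) (2 ^ k) _ ⟩
    2 ^ k * B ^ k * B ^ (k + s)        ≡⟨ cong (_* B ^ (k + s)) (sym (^-*-distrib 2 B k)) ⟩
    (2 * B) ^ k * B ^ (k + s)          ≤⟨ *-monoˡ-≤ (B ^ (k + s)) (^-monoˡ-≤ k 2B≤A) ⟩
    A ^ k * B ^ (k + s)                ≡⟨ cong (A ^ k *_) (^-distribˡ-+-* B k s) ⟩
    A ^ k * (B ^ k * B ^ s)            ≡⟨ sym (*-assoc (A ^ k) (B ^ k) (B ^ s)) ⟩
    A ^ k * B ^ k * B ^ s              ∎)
    where
    eq : ∀ x y z → x * y * z ≡ y * (x * z)
    eq = solve-∀
    eq′ : ∀ x y z → x * (y * z) ≡ y * x * z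
    eq′ = solve-∀

-- Edge sets as Boolean predicates

card : ∀ {m} → (Fin m → Bool) → ℕ
card B = sum (𝟙 ∘ B)

elements : ∀ {m} → (Fin m → Bool) → List (Fin m)
elements {m} B = filter (λ e → B e Bool.≟ true) (allFin m)

∈-elements⁺ : ∀ {m} (B : Fin m → Bool) {e} → B e ≡ true → e ∈ˡ elements B
∈-elements⁺ B {e} Be = ∈-filter⁺ (λ e → B e Bool.≟ true) (∈-allFin e) Be

∈-elements⁻ : ∀ {m} (B : Fin m → Bool) {e} → e ∈ˡ elements B → B e ≡ true
∈-elements⁻ {m} B e∈ = proj₂ (∈-filter⁻ (λ e → B e Bool.≟ true) {xs = allFin m} e∈)

elements-unique : ∀ {m} (B : Fin m → Bool) → Unique (elements B)
elements-unique {m} B = Unique.filter⁺ (λ e → B e Bool.≟ true) (Unique.allFin⁺ m)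

elements-cong : ∀ {m} {B C : Fin m → Bool} → (∀ e → B e ≡ C e) → elements B ≡ elements C
elements-cong {m} {B} {C} B≗C = filter-≐ (λ e → B e Bool.≟ true) (λ e → C e Bool.≟ true)
  ((λ {e} → trans (sym (B≗C e))) , (λ {e} → trans (B≗C e))) (allFin m)

length-filter-tabulate : ∀ {m} {A : Set} (f : Fin m → A) (B : A → Bool) →
                         length (filter (λ x → B x Bool.≟ true) (List.tabulate f)) ≡ sum (𝟙 ∘ B ∘ f)
length-filter-tabulate {zero}  f B = refl
length-filter-tabulate {suc m} f B with B (f zero)
... | true  = cong suc (length-filter-tabulate (f ∘ suc) B)
... | false = length-filter-tabulate (f ∘ suc) B

length-elements : ∀ {m} (B : Fin m → Bool) → length (elements B) ≡ card B
length-elements = length-filter-tabulate id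

_without_ : ∀ {m} → (Fin m → Bool) → Fin m → Fin m → Bool
(B without f) e = B e ∧ not (does (f Fin.≟ e))

without⁺ : ∀ {m} (B : Fin m → Bool) f {e} → B e ≡ true → e ≢ f → (B without f) e ≡ true
without⁺ B f {e} Be e≢f rewrite Be | dec-false (f Fin.≟ e) (e≢f ∘ sym) = refl

without⁻ : ∀ {m} (B : Fin m → Bool) f {e} → (B without f) e ≡ true → B e ≡ true × e ≢ f
without⁻ B f {e} h with B e | f Fin.≟ e
... | true | no f≢e = refl , f≢e ∘ sym

-- Connected components

module Components {n m} (G : Multigraph n m) where
  open Multigraph G

  redirect : Fin n → Fin n → Fin n → Fin n
  redirect x y z = if does (z Fin.≟ x) then y else z

  redirect-yes : ∀ {x y z} → z ≡ x → redirect x y z ≡ y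
  redirect-yes {x} {y} {z} z≡x rewrite dec-true (z Fin.≟ x) z≡x = refl

  redirect-no : ∀ {x y z} → z ≢ x → redirect x y z ≡ z
  redirect-no {x} {y} {z} z≢x rewrite dec-false (z Fin.≟ x) z≢x = refl

  redirect-target : ∀ x y → redirect x y y ≡ y
  redirect-target x y with y Fin.≟ x
  ... | yes _ = refl
  ... | no  _ = refl

  -- A representative of the component of v in the graph with edges L.
  label : List (Fin m) → Fin n → Fin n
  label []      v = v
  label (e ∷ L) v = redirect (label L (end₁ e)) (label L (end₂ e)) (label L v)

  -- The closure of L in the cycle matroid.
  Spans : List (Fin m) → Fin m → Set
  Spans L e = label L (end₁ e) ≡ label L (end₂ e)

  spans? : ∀ L e → Dec (Spans L e)
  spans? L e = label L (end₁ e) Fin.≟ label L (end₂ e)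

  label-cons-spanned : ∀ {e L} → Spans L e → ∀ v → label (e ∷ L) v ≡ label L v
  label-cons-spanned {e} {L} s v with label L v Fin.≟ label L (end₁ e)
  ... | yes p = trans (sym s) (sym p)
  ... | no  _ = refl

  label-idem : ∀ L v → label L (label L v) ≡ label L v
  label-idem []      v = refl
  label-idem (e ∷ L) v with label L v Fin.≟ label L (end₁ e)
  ... | yes p = trans (cong (redirect (label L (end₁ e)) (label L (end₂ e))) (label-idem L (end₂ e))) (redirect-target (label L (end₁ e)) (label L (end₂ e)))
  ... | no ¬p = trans (cong (redirect (label L (end₁ e)) (label L (end₂ e))) (label-idem L v)) (redirect-no ¬p)

  spans-member : ∀ {L e} → e ∈ˡ L → Spans L e
  spans-member {e ∷ L} (here refl) = trans (redirect-yes {label L (end₁ e)} refl) (sym (redirect-target (label L (end₁ e)) (label L (end₂ e))))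
  spans-member {f ∷ L} (there e∈L) = cong (redirect (label L (end₁ f)) (label L (end₂ f))) (spans-member e∈L)

  -- A vertex and its `L`-label are joined by edges of `L`, all of which `L′` spans, so `L′` cannot
  -- tell them apart.
  label-absorbs : ∀ L L′ → (∀ {e} → e ∈ˡ L → Spans L′ e) → ∀ v → label L′ (label L v) ≡ label L′ v
  label-absorbs []      L′ s v = refl
  label-absorbs (e ∷ L) L′ s v with label L v Fin.≟ label L (end₁ e)
  ... | no  _ = label-absorbs L L′ (s ∘ there) v
  ... | yes p = trans (label-absorbs L L′ (s ∘ there) (end₂ e)) (trans (sym (s (here refl)))
                (trans (sym (label-absorbs L L′ (s ∘ there) (end₁ e)))
                (trans (cong (label L′) (sym p)) (label-absorbs L L′ (s ∘ there) v))))

  label-mono : ∀ L L′ → (∀ {e} → e ∈ˡ L → Spans L′ e) → ∀ {u v} → label L u ≡ label L v → label L′ u ≡ label L′ v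
  label-mono L L′ s {u} {v} eq =
    trans (sym (label-absorbs L L′ s u)) (trans (cong (label L′) eq) (label-absorbs L L′ s v))

  spans-mono : ∀ L L′ → (∀ {e} → e ∈ˡ L → Spans L′ e) → ∀ {f} → Spans L f → Spans L′ f
  spans-mono L L′ s = label-mono L L′ s

  -- Adding `f` merges only the classes of its two ends. If this is what joins the ends of `e`, then
  -- these ends lie one in each of the two classes, so adding `e` instead causes the same merger.
  exchange : ∀ {e f L} → Spans (f ∷ L) e → ¬ Spans L e → Spans (e ∷ L) f
  exchange {e} {f} {L} s ¬s = go (lu Fin.≟ la) (lv Fin.≟ la)
    where
    la = label L (end₁ f)
    lb = label L (end₂ f)
    lu = label L (end₁ e)
    lv = label L (end₂ e)
    go : Dec (lu ≡ la) → Dec (lv ≡ la) → redirect lu lv la ≡ redirect lu lv lb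
    go (yes p) (yes q) = contradiction (trans p (sym q)) ¬s
    go (yes p) (no ¬q) = trans (redirect-yes (sym p)) (sym (trans (cong (redirect lu lv) lb≡lv) (redirect-target lu lv)))
      where
      lb≡lv : lb ≡ lv
      lb≡lv = trans (sym (redirect-yes p)) (trans s (redirect-no ¬q))
    go (no ¬p) (yes q) = trans (cong (redirect lu lv) (sym q)) (trans (redirect-target lu lv) (sym (redirect-yes (sym lu≡lb))))
      where
      lu≡lb : lu ≡ lb
      lu≡lb = trans (sym (redirect-no ¬p)) (trans s (redirect-yes q))
    go (no ¬p) (no ¬q) = contradiction (trans (sym (redirect-no ¬p)) (trans s (redirect-no ¬q))) ¬s

  isRoot : List (Fin m) → Fin n → Bool
  isRoot L v = does (label L v Fin.≟ v)

  isRoot-label : ∀ L v → isRoot L (label L v) ≡ true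
  isRoot-label L v = dec-true (label L (label L v) Fin.≟ label L v) (label-idem L v)

  #components : List (Fin m) → ℕ
  #components L = sum (𝟙 ∘ isRoot L)

  #components-spanned : ∀ {e L} → Spans L e → #components (e ∷ L) ≡ #components L
  #components-spanned {e} {L} s = sum-cong-≗ λ v → cong (λ x → 𝟙 (does (x Fin.≟ v))) (label-cons-spanned {e} {L} s v)

  -- Redirecting destroys exactly one root, the old label of `end₁ e`.
  #components-unspanned : ∀ {e L} → ¬ Spans L e → suc (#components (e ∷ L)) ≡ #components L
  #components-unspanned {e} {L} ¬s = sym (begin
    sum (𝟙 ∘ isRoot L)                                            ≡⟨ sum-cong-≗ pointwise ⟩
    sum (λ v → 𝟙 (does (la Fin.≟ v)) * 1 + 𝟙 (isRoot (e ∷ L) v))   ≡⟨ ∑-distrib-+ (λ v → 𝟙 (does (la Fin.≟ v)) * 1) (𝟙 ∘ isRoot (e ∷ L)) ⟩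
    sum (λ v → 𝟙 (does (la Fin.≟ v)) * 1) + #components (e ∷ L)    ≡⟨ cong (_+ #components (e ∷ L)) (sum-δ la (λ _ → 1)) ⟩
    suc (#components (e ∷ L))                                     ∎)
    where
    open ≡-Reasoning
    la = label L (end₁ e)
    lb = label L (end₂ e)
    pointwise : ∀ v → 𝟙 (isRoot L v) ≡ 𝟙 (does (la Fin.≟ v)) * 1 + 𝟙 (isRoot (e ∷ L) v)
    pointwise v with la Fin.≟ v
    ... | yes refl
      rewrite dec-true (label L la Fin.≟ la) (label-idem L (end₁ e))
            | dec-false (lb Fin.≟ la) (¬s ∘ sym) = refl
    ... | no la≢v with label L v Fin.≟ la
    ...   | no _ = refl
    ...   | yes p
      rewrite dec-false (label L v Fin.≟ v) (λ q → la≢v (trans (sym p) q))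
            | dec-false (lb Fin.≟ v) (λ q → ¬s (trans (sym p) (trans (cong (label L) (sym q)) (label-idem L (end₂ e))))) = refl

  -- Distinct roots of `L′` are separated by `L′`, hence by the finer partition of `L`; sending each
  -- to its `L`-label is therefore injective.
  #components-antitone : ∀ L L′ → (∀ {e} → e ∈ˡ L → Spans L′ e) → #components L′ ≤ #components L
  #components-antitone L L′ s = sum-𝟙-injection (isRoot L′) (isRoot L) (label L)
    (λ v _ → isRoot-label L v)
    (λ u v u-root v-root eq → trans (sym (does⇒ _ _ u-root)) (trans (label-mono L L′ s eq) (does⇒ _ _ v-root)))

  #components-∷ : ∀ e L → #components L ≤ suc (#components (e ∷ L))
  #components-∷ e L with spans? L e
  ... | yes s = ≤-trans (≤-reflexive (sym (#components-spanned {e} {L} s))) (n≤1+n _)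
  ... | no ¬s = ≤-reflexive (sym (#components-unspanned {e} {L} ¬s))

  #components-++ : ∀ J L → #components L ≤ length J + #components (J ++ L)
  #components-++ []      L = ≤-refl
  #components-++ (e ∷ J) L = ≤-trans (#components-++ J L)
    (≤-trans (+-monoʳ-≤ (length J) (#components-∷ e (J ++ L))) (≤-reflexive (+-suc (length J) _)))

  walk-++ : ∀ {F u v w} → Reachable F u v → Reachable F v w → Reachable F u w
  walk-++ ([] , [])               r = r
  walk-++ (_ ∷ ss , (p , j) ∷ ws) r = let _ , ws′ = walk-++ (ss , ws) r in _ , (p , j) ∷ ws′

  step : ∀ {F e} → F e → Reachable F (end₁ e) (end₂ e)
  step p = _ , (p , inj₁ (refl , refl)) ∷ []

  step⁻¹ : ∀ {F e} → F e → Reachable F (end₂ e) (end₁ e)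
  step⁻¹ p = _ , (p , inj₂ (refl , refl)) ∷ []

  label-reachable : ∀ {F : Pred (Fin m) 0ℓ} L → (∀ {e} → e ∈ˡ L → F e) → ∀ v → Reachable F v (label L v) × Reachable F (label L v) v
  label-reachable []      F⊇ v = ([] , []) , ([] , [])
  label-reachable (e ∷ L) F⊇ v with label L v Fin.≟ label L (end₁ e)
  ... | no  _ = label-reachable L (F⊇ ∘ there) v
  ... | yes p =
    let to , from = label-reachable L (F⊇ ∘ there) v
        to₁ , from₁ = label-reachable L (F⊇ ∘ there) (end₁ e)
        to₂ , from₂ = label-reachable L (F⊇ ∘ there) (end₂ e)
    in walk-++ to (walk-++ (subst (λ x → Reachable _ x (end₁ e)) (sym p) from₁) (walk-++ (step (F⊇ (here refl))) to₂))
     , walk-++ from₂ (walk-++ (step⁻¹ (F⊇ (here refl))) (walk-++ (subst (λ x → Reachable _ (end₁ e) x) (sym p) to₁) from))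

  label⇒reachable : ∀ {F : Pred (Fin m) 0ℓ} L → (∀ {e} → e ∈ˡ L → F e) → ∀ {u v} → label L u ≡ label L v → Reachable F u v
  label⇒reachable L F⊇ {u} {v} eq = walk-++ (proj₁ (label-reachable L F⊇ u))
    (subst (λ x → Reachable _ x v) (sym eq) (proj₂ (label-reachable L F⊇ v)))

  walk⇒label : ∀ {F u v ss} L → (∀ {e} → F e → Spans L e) → Walk F u ss v → label L u ≡ label L v
  walk⇒label L s [] = refl
  walk⇒label L s ((p , inj₁ (refl , refl)) ∷ ws) = trans (s p) (walk⇒label L s ws)
  walk⇒label L s ((p , inj₂ (refl , refl)) ∷ ws) = trans (sym (s p)) (walk⇒label L s ws)

does-∈? : ∀ {m} (x : Fin m) (T : Subset m) → does (x ∈ˢ? T) ≡ lookup T x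
does-∈? zero    (true  ∷ T) = refl
does-∈? zero    (false ∷ T) = refl
does-∈? (suc x) (_ ∷ T) = does-∈? x T

-- Minimum spanning trees

module Trees {n m} (G : Multigraph n m) where
  open Multigraph G
  open Components G

  -- Independence in the cycle matroid. It agrees with acyclicity, but exchanges can be checked on
  -- closures instead of on walks.
  Independent : (Fin m → Bool) → Set
  Independent T = ∀ {f} → T f ≡ true → ¬ Spans (elements (T without f)) f

  SimplePath : Pred (Fin m) 0ℓ → Fin n → Fin n → Set
  SimplePath F u v = ∃[ ss ] (Walk F u ss v × Unique (map proj₁ ss) × v ∉ˡ map proj₁ ss)

  suffix : ∀ {F u v w ss} → w ∈ˡ map proj₁ ss → Walk F u ss v → Unique (map proj₁ ss) → v ∉ˡ map proj₁ ss → SimplePath F w v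
  suffix (here refl) ws@(_ ∷ _) un v∉ = _ , ws , un , v∉
  suffix (there w∈)  (_ ∷ ws) (_ ∷ un) v∉ = suffix w∈ ws un (v∉ ∘ there)

  simplePath : ∀ {F u v ss} → Walk F u ss v → SimplePath F u v
  simplePath [] = [] , [] , [] , λ ()
  simplePath {F} {u} {v} (s ∷ ws) with simplePath ws
  ... | ss , ws′ , un , v∉ with u Fin.≟ v | _∈?_ Fin._≟_ u (map proj₁ ss)
  ...   | yes refl | _      = [] , [] , [] , λ ()
  ...   | no _     | yes u∈ = suffix u∈ ws′ un v∉
  ...   | no u≢v   | no u∉  = _ , s ∷ ws′ , All.¬Any⇒All¬ _ u∉ ∷ un , λ where
    (here v≡u)  → u≢v (sym v≡u)
    (there v∈)  → v∉ v∈

  ends-on-walk : ∀ {F u v e ss} → Walk F u ss v → e ∈ˡ map proj₂ ss →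
                 (end₁ e ∈ˡ map proj₁ ss ⊎ end₁ e ≡ v) × (end₂ e ∈ˡ map proj₁ ss ⊎ end₂ e ≡ v)
  ends-on-walk {F} {v = w} (_∷_ {v = x} (_ , j) ws) (here refl) = ends j
    where
    first : ∀ {x ss} → Walk F x ss w → x ∈ˡ map proj₁ ss ⊎ x ≡ w
    first []      = inj₂ refl
    first (_ ∷ _) = inj₁ (here refl)
    next : ∀ {y u ss} → x ∈ˡ ss ⊎ x ≡ w → y ≡ x → y ∈ˡ u ∷ ss ⊎ y ≡ w
    next (inj₁ x∈) refl = inj₁ (there x∈)
    next (inj₂ p)  refl = inj₂ p
    ends : ∀ {e u} → Joins e u x → _
    ends (inj₁ (p , q)) = inj₁ (here p) , next (first ws) q
    ends (inj₂ (p , q)) = next (first ws) p , inj₁ (here q)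
  ends-on-walk (_ ∷ ws) (there e∈) = let a , b = ends-on-walk ws e∈ in later a , later b
    where
    later : ∀ {y u v ss} → y ∈ˡ ss ⊎ y ≡ v → y ∈ˡ u ∷ ss ⊎ y ≡ v
    later (inj₁ y∈) = inj₁ (there y∈)
    later (inj₂ p)  = inj₂ p

  -- If the first edge were used again, both of its ends would lie on the rest of the walk, and with
  -- them the starting vertex.
  simple-edges-unique : ∀ {F u v ss} → Walk F u ss v → Unique (map proj₁ ss) → v ∉ˡ map proj₁ ss → Unique (map proj₂ ss)
  simple-edges-unique [] un v∉ = []
  simple-edges-unique {v = v} (_∷_ {u = u} {e = e} {ss = ss} (_ , j) ws) (u∉ ∷ un) v∉ =
    All.¬Any⇒All¬ _ fresh ∷ simple-edges-unique ws un (v∉ ∘ there)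
    where
    off : ∀ {y} → y ≡ u → y ∈ˡ map proj₁ ss ⊎ y ≡ v → _
    off refl (inj₁ u∈) = All.All¬⇒¬Any u∉ u∈
    off refl (inj₂ refl) = v∉ (here refl)
    fresh : e ∉ˡ map proj₂ ss
    fresh e∈ = case j , ends-on-walk ws e∈ of λ where
      (inj₁ (p , _) , a , _) → off p a
      (inj₂ (_ , q) , _ , b) → off q b

  walk-edges : ∀ {F u v ss} → Walk F u ss v → All F (map proj₂ ss)
  walk-edges [] = []
  walk-edges ((p , _) ∷ ws) = p ∷ walk-edges ws

  walk-restrict : ∀ {F F′ : Pred (Fin m) 0ℓ} {u v ss} → Walk F u ss v → (∀ {e} → F e → e ∈ˡ map proj₂ ss → F′ e) → Walk F′ u ss v
  walk-restrict [] f = []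
  walk-restrict ((p , j) ∷ ws) f = (f p (here refl) , j) ∷ walk-restrict ws (λ q → f q ∘ there)

  -- If `f` is spanned by the other edges of `T`, a simple path through them between its ends closes
  -- up with `f` to a cycle.
  acyclic⇒independent : ∀ {T} → Acyclic (λ e → T e ≡ true) → Independent T
  acyclic⇒independent {T} acyclic {f} Tf s
    with simplePath (proj₂ (label⇒reachable {λ e → T e ≡ true × e ≢ f} (elements (T without f)) (without⁻ T f ∘ ∈-elements⁻ (T without f)) (sym s)))
  ... | ss , ws , un , a∉ = acyclic (end₁ f) ((end₁ f , f) ∷ ss)
    ( (Tf , inj₁ (refl , refl)) ∷ walk-restrict ws (λ p _ → proj₁ p) , (λ ())
    , All.¬Any⇒All¬ _ a∉ ∷ un
    , All.map (λ p f≡e → proj₂ p (sym f≡e)) (walk-edges ws) ∷ simple-edges-unique ws un a∉ )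

  independent⇒acyclic : ∀ {T} → Independent T → Acyclic (λ e → T e ≡ true)
  independent⇒acyclic ind v [] (_ , ss≢[] , _) = ss≢[] refl
  independent⇒acyclic {T} ind v ((.v , e) ∷ ss) ((Te , j) ∷ ws , _ , _ , e∉ ∷ un) = ind Te (spans j {{ws}})
    where
    rest : ∀ {x} → Walk (λ e → T e ≡ true) x ss v → label (elements (T without e)) x ≡ label (elements (T without e)) v
    rest ws = walk⇒label (elements (T without e)) (λ p → spans-member (∈-elements⁺ (T without e) p))
      (walk-restrict {F′ = λ x → (T without e) x ≡ true} ws λ p x∈ → without⁺ T e p λ { refl → All.All¬⇒¬Any e∉ x∈ })
    spans : ∀ {x} → Joins e v x → {{Walk (λ e → T e ≡ true) x ss v}} → Spans (elements (T without e)) e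
    spans (inj₁ (refl , refl)) {{ws}} = sym (rest ws)
    spans (inj₂ (refl , refl)) {{ws}} = rest ws

  spansAll : ∀ {T} → ConnectedVia (λ e → T e ≡ true) → ∀ u v → label (elements T) u ≡ label (elements T) v
  spansAll {T} conn u v = walk⇒label (elements T) (spans-member ∘ ∈-elements⁺ T) (proj₂ (conn u v))

  connectedVia : ∀ {T} → (∀ u v → label (elements T) u ≡ label (elements T) v) → ConnectedVia (λ e → T e ≡ true)
  connectedVia {T} eq u v = label⇒reachable (elements T) (∈-elements⁻ T) (eq u v)

  swap : (Fin m → Bool) → Fin m → Fin m → Fin m → Bool
  swap T f e x = does (e Fin.≟ x) ∨ (T without f) x

  -- If another edge `x` became spanned only through `e`, then by `exchange` the edges of `T` other
  -- than `f` would already span `e`.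
  swap-independent : ∀ {T e f} → Independent T → ¬ Spans (elements (T without f)) e → Independent (swap T f e)
  swap-independent {T} {e} {f} ind ¬s {x} T′x s with e Fin.≟ x
  ... | yes refl = ¬s (spans-mono (elements (swap T f e without e)) (elements (T without f)) keep s)
    where
    keep : ∀ {y} → y ∈ˡ elements (swap T f e without e) → Spans (elements (T without f)) y
    keep {y} y∈ with without⁻ (swap T f e) e (∈-elements⁻ (swap T f e without e) y∈)
    ... | T′y , y≢e with e Fin.≟ y
    ...   | yes p = contradiction (sym p) y≢e
    ...   | no  _ = spans-member (∈-elements⁺ (T without f) T′y)
  ... | no e≢x = ¬s (spans-mono (x ∷ elements T₀) (elements (T without f)) back
                     (exchange {x} {e} {elements T₀} (spans-mono (elements (swap T f e without x)) (e ∷ elements T₀) keep s) ¬s₀))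
    where
    T₀ : Fin m → Bool
    T₀ = (T without f) without x
    Tx = without⁻ T f T′x
    ¬s₀ : ¬ Spans (elements T₀) x
    ¬s₀ s₀ = ind (proj₁ Tx) (spans-mono (elements T₀) (elements (T without x)) (λ y∈ →
      let p , y≢x = without⁻ (T without f) x (∈-elements⁻ T₀ y∈)
      in spans-member (∈-elements⁺ (T without x) (without⁺ T x (proj₁ (without⁻ T f p)) y≢x))) s₀)
    keep : ∀ {y} → y ∈ˡ elements (swap T f e without x) → Spans (e ∷ elements T₀) y
    keep {y} y∈ with without⁻ (swap T f e) x (∈-elements⁻ (swap T f e without x) y∈)
    ... | T′y , y≢x with e Fin.≟ y
    ...   | yes refl = spans-member {e ∷ elements T₀} (here refl)
    ...   | no  _    = spans-member {e ∷ elements T₀} (there (∈-elements⁺ T₀ (without⁺ (T without f) x T′y y≢x)))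
    back : ∀ {y} → y ∈ˡ x ∷ elements T₀ → Spans (elements (T without f)) y
    back (here refl) = spans-member (∈-elements⁺ (T without f) T′x)
    back (there y∈)  = spans-member (∈-elements⁺ (T without f) (proj₁ (without⁻ (T without f) x (∈-elements⁻ T₀ y∈))))

  swap-connected : ∀ {T e f} → ConnectedVia (λ x → T x ≡ true) → Spans (e ∷ elements (T without f)) f →
                   ConnectedVia (λ x → swap T f e x ≡ true)
  swap-connected {T} {e} {f} conn s = connectedVia {swap T f e} λ u v → label-mono (elements T) (elements (swap T f e)) keep (spansAll {T} conn u v)
    where
    new : ∀ {x} → x ∈ˡ e ∷ elements (T without f) → Spans (elements (swap T f e)) x
    new (here refl) = spans-member (∈-elements⁺ (swap T f e) (cong (_∨ (T without f) e) (dec-true (e Fin.≟ e) refl)))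
    new {x} (there x∈) = spans-member (∈-elements⁺ (swap T f e) (trans (cong (does (e Fin.≟ x) ∨_) (∈-elements⁻ (T without f) x∈)) (Bool.∨-zeroʳ _)))
    keep : ∀ {x} → x ∈ˡ elements T → Spans (elements (swap T f e)) x
    keep {x} x∈ with x Fin.≟ f
    ... | yes refl = spans-mono (e ∷ elements (T without f)) (elements (swap T f e)) new s
    ... | no x≢f   = new (there (∈-elements⁺ (T without f) (without⁺ T f (∈-elements⁻ T x∈) x≢f)))

  weight-as-sum : ∀ w T → weight w T ≡ sum (λ e → 𝟙 (lookup T e) * w e)
  weight-as-sum w T = go id
    where
    go : ∀ {l} (f : Fin l → Fin m) → ListAction.sum (map w (filter (_∈ˢ? T) (List.tabulate f))) ≡ sum (λ i → 𝟙 (lookup T (f i)) * w (f i))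
    go {zero}  f = refl
    go {suc l} f rewrite sym (does-∈? (f zero) T) with does (f zero ∈ˢ? T)
    ... | true  = cong₂ _+_ (sym (*-identityˡ _)) (go (f ∘ suc))
    ... | false = go (f ∘ suc)

  swap-weight : ∀ {T e f} (w : Fin m → ℕ) → T f ≡ true → T e ≡ false →
                sum (λ x → 𝟙 (swap T f e x) * w x) + w f ≡ sum (λ x → 𝟙 (T x) * w x) + w e
  swap-weight {T} {e} {f} w Tf Te = begin
    sum (λ x → 𝟙 (swap T f e x) * w x) + w f                     ≡⟨ cong (sum (λ x → 𝟙 (swap T f e x) * w x) +_) (sym (sum-δ f w)) ⟩
    sum (λ x → 𝟙 (swap T f e x) * w x) + sum (λ x → δ f x * w x)  ≡⟨ sym (∑-distrib-+ (λ x → 𝟙 (swap T f e x) * w x) (λ x → δ f x * w x)) ⟩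
    sum (λ x → 𝟙 (swap T f e x) * w x + δ f x * w x)             ≡⟨ sum-cong-≗ pointwise ⟩
    sum (λ x → 𝟙 (T x) * w x + δ e x * w x)                      ≡⟨ ∑-distrib-+ (λ x → 𝟙 (T x) * w x) (λ x → δ e x * w x) ⟩
    sum (λ x → 𝟙 (T x) * w x) + sum (λ x → δ e x * w x)          ≡⟨ cong (sum (λ x → 𝟙 (T x) * w x) +_) (sum-δ e w) ⟩
    sum (λ x → 𝟙 (T x) * w x) + w e                              ∎
    where
    open ≡-Reasoning
    δ : Fin m → Fin m → ℕ
    δ y x = 𝟙 (does (y Fin.≟ x))
    pointwise : ∀ x → 𝟙 (swap T f e x) * w x + δ f x * w x ≡ 𝟙 (T x) * w x + δ e x * w x
    pointwise x with e Fin.≟ x | f Fin.≟ x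
    ... | yes refl | yes refl = contradiction (trans (sym Tf) Te) λ ()
    ... | yes refl | no  _    rewrite Te = +-comm _ 0
    ... | no  _    | no  _    rewrite Bool.∧-identityʳ (T x) = refl
    ... | no  _    | yes refl rewrite Tf = sym (+-identityʳ _)

  -- Edges of `J` are dropped one at a time until `e` leaves the span. The edge responsible lies on
  -- a cycle closed by `e`, so `exchange` recovers it from `e` and the edges still present. This
  -- finds an edge of a fundamental cycle without constructing the cycle.
  last-needed : ∀ J {L e} → Unique J → Spans (J ++ L) e → ¬ Spans L e →
                ∃[ f ] (f ∈ˡ J × ∃[ J′ ] ((∀ {x} → x ∈ˡ J′ → x ∈ˡ J × x ≢ f) × Spans (e ∷ J′ ++ L) f))
  last-needed [] un s ¬s = contradiction s ¬s
  last-needed (f ∷ J) {L} {e} (f∉ ∷ un) s ¬s with spans? (J ++ L) e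
  ... | no ¬s′ = f , here refl , J , (λ x∈ → there x∈ , λ { refl → All.All¬⇒¬Any f∉ x∈ }) , exchange {e} {f} {J ++ L} s ¬s′
  ... | yes s′ = let g , g∈ , J′ , J′⊆ , s″ = last-needed J {L} {e} un s′ ¬s
                 in g , there g∈ , J′ , (λ x∈ → let a , b = J′⊆ x∈ in there a , b) , s″

  tree-independent : ∀ {T} → IsSpanningTree T → Independent (lookup T)
  tree-independent {T} (_ , acyc) = acyclic⇒independent {lookup T} λ v ss (ws , rest) →
    acyc v ss (walk-restrict ws (λ {x} p _ → lookup⇒[]= x T p) , rest)

  -- Kruskal's property.  If e were not spanned, then removing a suitable heavier edge f
  -- from T would unspan e, and exchanging f for e would give a lighter tree.
  mst-spans : ∀ {w T} → IsMinimumSpanningTree w T → (F : Fin m → Bool) →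
              (∀ {e f} → F e ≡ true → w f ≤ w e → F f ≡ true) →
              ∀ {e} → F e ≡ true → Spans (elements (λ x → lookup T x ∧ F x)) e
  mst-spans {w} {T} ((conn , acyc) , minimal) F down {e} Fe = decidable-stable (spans? (elements T∩F) e) λ ¬s →
    absurd (last-needed (elements T∖F) {elements T∩F} {e} (elements-unique T∖F) (spansE) ¬s)
    where
    t T∩F T∖F : Fin m → Bool
    t = lookup T
    T∩F x = t x ∧ F x
    T∖F x = t x ∧ not (F x)
    true≢false : ∀ {b} → b ≡ true → b ≢ false
    true≢false refl ()
    not-true : ∀ {b} → not b ≡ true → b ≡ false
    not-true {false} _ = refl
    conn′ : ConnectedVia (λ x → t x ≡ true)
    conn′ u v = let ss , ws = conn u v in ss , walk-restrict ws λ p _ → []=⇒lookup p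
    ind : Independent t
    ind = tree-independent (conn , acyc)
    spansE : Spans (elements T∖F ++ elements T∩F) e
    spansE = label-mono (elements t) (elements T∖F ++ elements T∩F) covers (spansAll {t} conn′ (end₁ e) (end₂ e))
      where
      covers : ∀ {x} → x ∈ˡ elements t → Spans (elements T∖F ++ elements T∩F) x
      covers {x} x∈ with F x in Fx
      ... | true  = spans-member (∈-++⁺ʳ (elements T∖F) (∈-elements⁺ T∩F (cong₂ _∧_ (∈-elements⁻ t x∈) Fx)))
      ... | false = spans-member (∈-++⁺ˡ (∈-elements⁺ T∖F (cong₂ _∧_ (∈-elements⁻ t x∈) (cong not Fx))))
    lighter : ∀ {f T′} → (∀ x → lookup T′ x ≡ swap t f e x) → t f ≡ true → t e ≡ false → w e < w f →
              weight w T′ + w f < weight w T + w f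
    lighter {f} {T′} T′-swap Tf Te we<wf = begin-strict
      weight w T′ + w f                              ≡⟨ cong (_+ w f) (weight-as-sum w T′) ⟩
      sum (λ x → 𝟙 (lookup T′ x) * w x) + w f        ≡⟨ cong (_+ w f) (sum-cong-≗ λ x → cong (λ b → 𝟙 b * w x) (T′-swap x)) ⟩
      sum (λ x → 𝟙 (swap t f e x) * w x) + w f       ≡⟨ swap-weight {t} {e} {f} w Tf Te ⟩
      sum (λ x → 𝟙 (t x) * w x) + w e                ≡⟨ cong (_+ w e) (sym (weight-as-sum w T)) ⟩
      weight w T + w e                               <⟨ +-monoʳ-< (weight w T) we<wf ⟩
      weight w T + w f                               ∎
      where open ≤-Reasoning
    absurd : ∃[ f ] (f ∈ˡ elements T∖F × ∃[ J′ ] ((∀ {x} → x ∈ˡ J′ → x ∈ˡ elements T∖F × x ≢ f) × Spans (e ∷ J′ ++ elements T∩F) f)) → ⊥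
    absurd (f , f∈ , J′ , J′⊆ , s) = let
        Tf , ¬Ff = ∧-splits (∈-elements⁻ T∖F f∈)
        keep : ∀ {x} → x ∈ˡ e ∷ J′ ++ elements T∩F → x ∈ˡ e ∷ elements (t without f)
        keep = λ where
          (here p) → here p
          (there x∈) → there (∈-elements⁺ (t without f) (case ∈-++⁻ J′ x∈ of λ where
            (inj₁ x∈J′) → without⁺ t f (proj₁ (∧-splits (∈-elements⁻ T∖F (proj₁ (J′⊆ x∈J′))))) (proj₂ (J′⊆ x∈J′))
            (inj₂ x∈F)  → let Tx , Fx = ∧-splits (∈-elements⁻ T∩F x∈F) in
              without⁺ t f Tx λ { refl → true≢false Fx (not-true ¬Ff) }))
        s₁ : Spans (e ∷ elements (t without f)) f
        s₁ = spans-mono (e ∷ J′ ++ elements T∩F) (e ∷ elements (t without f)) (spans-member ∘ keep) s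
        ¬s₁ : ¬ Spans (elements (t without f)) e
        -- By `s₁`, if the tree without `f` spanned `e`, it would span `f` as well, against
        -- independence.
        ¬s₁ = λ s₂ → ind Tf (spans-mono (e ∷ elements (t without f)) (elements (t without f))
          (λ { (here refl) → s₂ ; (there x∈) → spans-member x∈ }) s₁)
        e≢f : e ≢ f
        e≢f = λ { refl → true≢false Fe (not-true ¬Ff) }
        Te : t e ≡ false
        Te = Bool.¬-not λ Te → ¬s₁ (spans-member (∈-elements⁺ (t without f) (without⁺ t f Te e≢f)))
        we<wf : w e < w f
        we<wf = ≰⇒> λ wf≤we → true≢false (down Fe wf≤we) (not-true ¬Ff)
        T′ = tabulate (swap t f e)
        T′-swap : ∀ x → lookup T′ x ≡ swap t f e x
        T′-swap = lookup∘tabulate (swap t f e)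
        T′-tree : IsSpanningTree T′
        T′-tree = (λ u v → let ss , ws = swap-connected {t} {e} {f} conn′ s₁ u v in
                      ss , walk-restrict ws λ {x} p _ → lookup⇒[]= x T′ (trans (T′-swap x) p))
                , λ v ss (ws , rest) → independent⇒acyclic (swap-independent {t} {e} {f} ind ¬s₁) v ss
                    (walk-restrict ws (λ {x} p _ → trans (sym (T′-swap x)) ([]=⇒lookup p)) , rest)
      in <⇒≱ (+-cancelʳ-< (w f) (weight w T′) (weight w T) (lighter {f} {T′} T′-swap Tf Te we<wf)) (minimal T′ T′-tree)

-- Potentials and load bounds

card-split : ∀ {m} (B H : Fin m → Bool) → card B ≡ card (λ e → B e ∧ not (H e)) + card (λ e → B e ∧ H e)
card-split B H = trans (sum-cong-≗ λ e → split (B e) (H e)) (∑-distrib-+ (λ e → 𝟙 (B e ∧ not (H e))) (λ e → 𝟙 (B e ∧ H e)))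
  where
  split : ∀ b h → 𝟙 b ≡ 𝟙 (b ∧ not h) + 𝟙 (b ∧ h)
  split true  true  = refl
  split true  false = refl
  split false h     = refl

card-∨ : ∀ {m} (B H : Fin m → Bool) → card (λ e → B e ∨ H e) ≡ card B + card (λ e → not (B e) ∧ H e)
card-∨ B H = trans (sum-cong-≗ λ e → split (B e) (H e)) (∑-distrib-+ (𝟙 ∘ B) (λ e → 𝟙 (not (B e) ∧ H e)))
  where
  split : ∀ b h → 𝟙 (b ∨ h) ≡ 𝟙 b + 𝟙 (not b ∧ h)
  split true  h = refl
  split false h = refl

module _ {N : ℕ} .{{_ : NonZero N}} where

  excess : ∀ u v d {m} → suc N ^ (u + d) * N ^ v ≤ m * (N ^ (v + d) * suc N ^ u) → suc N ^ d ≤ m * N ^ d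
  excess u v d {m} h = *-cancelˡ-≤ (suc N ^ u * N ^ v) {{m*n≢0 (suc N ^ u) (N ^ v) {{m^n≢0 (suc N) u}} {{m^n≢0 N v}}}}
    (subst₂ _≤_
      (trans (cong (_* N ^ v) (^-distribˡ-+-* (suc N) u d)) (eq (suc N ^ u) (suc N ^ d) (N ^ v)))
      (trans (cong (λ x → m * (x * suc N ^ u)) (^-distribˡ-+-* N v d)) (eq′ m (N ^ v) (N ^ d) (suc N ^ u)))
      h)
    where
    eq : ∀ x y z → x * y * z ≡ x * z * y
    eq = solve-∀
    eq′ : ∀ m x y z → m * (x * y * z) ≡ z * x * (m * y)
    eq′ = solve-∀

module Potential {n m} (G : Multigraph n m) where
  open Multigraph G
  open Components G
  open Trees G

  -- At a maximizer D, deleting edges from D loses at least, and adding edges gains at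
  -- most, ν / p edges per unit of rank: the ideal loads are ≤ p / ν on D and ≥ p / ν off D.
  objective : ℕ → ℕ → (Fin m → Bool) → ℕ
  objective ν p B = ν * #components (elements B) + p * card B

  -- Each edge of an independent list merges two components. Independence is required relative to a
  -- fixed `P` containing `J`, so that the hypothesis survives the recursion on `J`.
  #components-independent : ∀ {P : Fin m → Set} {L} J → Unique J → (∀ {x} → x ∈ˡ J → P x) →
    (∀ {f J′} → P f → (∀ {x} → x ∈ˡ J′ → P x × x ≢ f) → ¬ Spans (J′ ++ L) f) →
    length J + #components (J ++ L) ≡ #components L
  #components-independent [] un J⊆P ind = refl
  #components-independent {L = L} (f ∷ J) (f∉ ∷ un) J⊆P ind =
    trans (sym (+-suc (length J) _))
    (trans (cong (length J +_) (#components-unspanned {f} {J ++ L}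
              (ind (J⊆P (here refl)) λ x∈ → J⊆P (there x∈) , λ { refl → All.All¬⇒¬Any f∉ x∈ })))
    (#components-independent J un (J⊆P ∘ there) ind))

  module _ {w : Fin m → ℕ} {tree : Subset m} (mst : IsMinimumSpanningTree w tree) where
    private
      t : Fin m → Bool
      t = lookup tree
      ind : Independent t
      ind = tree-independent (proj₁ mst)

    -- Delete the heavy edges `H` from `D`. By Kruskal's property the light tree edges span all
    -- light edges, so the heavy tree edges in `D` are independent over what remains, and the
    -- deletion creates at least that many components. Optimality of `D` weighs `ν` for each of
    -- these against `p` for each deleted edge.
    heavy-tree-edges : ∀ {ν p} (D H : Fin m → Bool) →
      (∀ B → (∀ {e} → B e ≡ true → D e ≡ true) → objective ν p B ≤ objective ν p D) →
      (∀ {e f} → H e ≡ true → w e ≤ w f → H f ≡ true) →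
      ν * card (λ e → (t e ∧ D e) ∧ H e) ≤ p * card (λ e → D e ∧ H e)
    heavy-tree-edges {ν} {p} D H optimal up = +-cancelˡ-≤ (ν * c D + p * card B) _ _ (begin
      ν * c D + p * card B + ν * card J       ≡⟨ eq₁ ν (c D) (p * card B) (card J) ⟩
      ν * (card J + c D) + p * card B         ≤⟨ +-monoˡ-≤ (p * card B) (*-monoʳ-≤ ν rank-drop) ⟩
      ν * c B + p * card B                    ≤⟨ optimal B (proj₁ ∘ ∧-splits) ⟩
      ν * c D + p * card D                    ≡⟨ cong (λ x → ν * c D + p * x) (card-split D H) ⟩
      ν * c D + p * (card B + card (λ e → D e ∧ H e))   ≡⟨ eq₂ (ν * c D) p (card B) _ ⟩
      ν * c D + p * card B + p * card (λ e → D e ∧ H e) ∎)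
      where
      open ≤-Reasoning
      c : (Fin m → Bool) → ℕ
      c B = #components (elements B)
      B J F : Fin m → Bool
      B e = D e ∧ not (H e)
      J e = (t e ∧ D e) ∧ H e
      F e = not (H e)
      eq₁ : ∀ ν x y z → ν * x + y + ν * z ≡ ν * (z + x) + y
      eq₁ = solve-∀
      eq₂ : ∀ x p y z → x + p * (y + z) ≡ x + p * y + p * z
      eq₂ = solve-∀
      clash : ∀ {b} → not b ≡ true → b ≢ true
      clash {false} _ ()
      F-down : ∀ {e f} → F e ≡ true → w f ≤ w e → F f ≡ true
      F-down {e} {f} Fe wf≤we with H f in Hf
      ... | false = refl
      ... | true  = contradiction (up Hf wf≤we) (clash Fe)
      Pr : Fin m → Set
      Pr e = J e ≡ true
      J-splits : ∀ {e} → Pr e → (t e ≡ true × D e ≡ true) × H e ≡ true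
      J-splits {e} Je = let a , b = ∧-splits {t e ∧ D e} Je in ∧-splits {t e} a , b
      unspanned : ∀ {f J′} → Pr f → (∀ {x} → x ∈ˡ J′ → Pr x × x ≢ f) → ¬ Spans (J′ ++ elements B) f
      unspanned {f} {J′} Jf J′⊆ s = ind (proj₁ (proj₁ (J-splits Jf)))
        (spans-mono (J′ ++ elements B) (elements (t without f)) covered s)
        where
        covered : ∀ {x} → x ∈ˡ J′ ++ elements B → Spans (elements (t without f)) x
        covered {x} x∈ with ∈-++⁻ J′ x∈
        ... | inj₁ x∈J′ = spans-member (∈-elements⁺ (t without f)
                (without⁺ t f (proj₁ (proj₁ (J-splits (proj₁ (J′⊆ x∈J′))))) (proj₂ (J′⊆ x∈J′))))
        ... | inj₂ x∈B = spans-mono (elements (λ y → t y ∧ F y)) (elements (t without f))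
                (λ y∈ → let ty , Fy = ∧-splits (∈-elements⁻ (λ y → t y ∧ F y) y∈) in
                  spans-member (∈-elements⁺ (t without f) (without⁺ t f ty λ { refl → clash Fy (proj₂ (J-splits Jf)) })))
                (mst-spans mst F F-down (proj₂ (∧-splits (∈-elements⁻ B x∈B))))
      rank-drop : card J + c D ≤ c B
      rank-drop = begin
        card J + c D                                              ≤⟨ +-monoʳ-≤ (card J) (#components-antitone (elements J ++ elements B) (elements D) inside-D) ⟩
        card J + #components (elements J ++ elements B)           ≡⟨ cong (_+ #components (elements J ++ elements B)) (sym (length-elements J)) ⟩
        length (elements J) + #components (elements J ++ elements B) ≡⟨ #components-independent {Pr} {elements B} (elements J) (elements-unique J) (∈-elements⁻ J) unspanned ⟩
        c B                                                       ∎
        where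
        inside-D : ∀ {x} → x ∈ˡ elements J ++ elements B → Spans (elements D) x
        inside-D x∈ with ∈-++⁻ (elements J) x∈
        ... | inj₁ x∈J = spans-member (∈-elements⁺ D (proj₂ (proj₁ (J-splits (∈-elements⁻ J x∈J)))))
        ... | inj₂ x∈B = spans-member (∈-elements⁺ D (proj₁ (∧-splits (∈-elements⁻ B x∈B))))

    -- The dual argument: add the light edges `F` to `D`. Together with `D`, the light tree edges
    -- outside `D` span all that was added, so at most that many components disappear.
    light-tree-edges : ∀ {ν p} (D F : Fin m → Bool) →
      (∀ B → (∀ {e} → D e ≡ true → B e ≡ true) → objective ν p B ≤ objective ν p D) →
      (∀ {e f} → F e ≡ true → w f ≤ w e → F f ≡ true) →
      p * card (λ e → not (D e) ∧ F e) ≤ ν * card (λ e → (t e ∧ not (D e)) ∧ F e)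
    light-tree-edges {ν} {p} D F optimal down = +-cancelˡ-≤ (ν * c B + p * card D) _ _ (begin
      ν * c B + p * card D + p * card (λ e → not (D e) ∧ F e)  ≡⟨ eq₂ (ν * c B) p (card D) _ ⟩
      ν * c B + p * (card D + card (λ e → not (D e) ∧ F e))    ≡⟨ cong (λ x → ν * c B + p * x) (sym (card-∨ D F)) ⟩
      ν * c B + p * card B                    ≤⟨ optimal B (λ {e} De → cong (_∨ F e) De) ⟩
      ν * c D + p * card D                    ≤⟨ +-monoˡ-≤ (p * card D) (*-monoʳ-≤ ν rank-rise) ⟩
      ν * (card J + c B) + p * card D         ≡⟨ eq₁ ν (c B) (p * card D) (card J) ⟩
      ν * c B + p * card D + ν * card J       ∎)
      where
      open ≤-Reasoning
      c : (Fin m → Bool) → ℕ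
      c B = #components (elements B)
      B J : Fin m → Bool
      B e = D e ∨ F e
      J e = (t e ∧ not (D e)) ∧ F e
      eq₁ : ∀ ν x y z → ν * (z + x) + y ≡ ν * x + y + ν * z
      eq₁ = solve-∀
      eq₂ : ∀ x p y z → x + p * y + p * z ≡ x + p * (y + z)
      eq₂ = solve-∀
      rank-rise : c D ≤ card J + c B
      rank-rise = begin
        c D                                                          ≤⟨ #components-++ (elements J) (elements D) ⟩
        length (elements J) + #components (elements J ++ elements D) ≡⟨ cong (_+ #components (elements J ++ elements D)) (length-elements J) ⟩
        card J + #components (elements J ++ elements D)              ≤⟨ +-monoʳ-≤ (card J) (#components-antitone (elements B) (elements J ++ elements D) covers) ⟩
        card J + c B                                                 ∎
        where
        covers : ∀ {x} → x ∈ˡ elements B → Spans (elements J ++ elements D) x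
        covers {x} x∈ with D x in Dx
        ... | true  = spans-member (∈-++⁺ʳ (elements J) (∈-elements⁺ D Dx))
        ... | false = spans-mono (elements (λ y → t y ∧ F y)) (elements J ++ elements D) tree-edge
                        (mst-spans mst F down (trans (sym (cong (_∨ F x) Dx)) (∈-elements⁻ B x∈)))
          where
          tree-edge : ∀ {y} → y ∈ˡ elements (λ y → t y ∧ F y) → Spans (elements J ++ elements D) y
          tree-edge {y} y∈ with ∧-splits {t y} (∈-elements⁻ (λ y → t y ∧ F y) y∈) | D y in Dy
          ... | _       | true  = spans-member (∈-++⁺ʳ (elements J) (∈-elements⁺ D Dy))
          ... | ty , Fy | false = spans-member (∈-++⁺ˡ {ys = elements D} (∈-elements⁺ J (cong₂ _∧_ (cong₂ _∧_ ty (cong not Dy)) Fy)))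

  module Growth (X Y : ℕ) where

    -- This is `(X / Y) ^ load` scaled by `Y ^ k`. For `X > Y` the potential is dominated by heavily
    -- loaded edges, for `X < Y` by lightly loaded ones; both load bounds use the same formula.
    weightOf : ∀ {k} → Vec (Subset m) k → Fin m → ℕ
    weightOf {k} 𝒯 e = X ^ load 𝒯 e * Y ^ (k ∸ load 𝒯 e)

    potential : ∀ {k} → Vec (Subset m) k → (Fin m → Bool) → ℕ
    potential 𝒯 A = sum (λ e → weightOf 𝒯 e * 𝟙 (A e))

    load≤ : ∀ {k} (𝒯 : Vec (Subset m) k) e → load 𝒯 e ≤ k
    load≤ 𝒯 e = count≤n (e ∈ˢ?_) 𝒯

    weightOf-∷ : ∀ {k} (tree : Subset m) (𝒯 : Vec (Subset m) k) e →
                 weightOf (tree ∷ 𝒯) e ≡ (if lookup tree e then X else Y) * weightOf 𝒯 e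
    weightOf-∷ {k} tree 𝒯 e rewrite sym (does-∈? e tree) with does (e ∈ˢ? tree)
    ... | true  = *-assoc X (X ^ load 𝒯 e) _
    ... | false = trans (cong (λ x → X ^ load 𝒯 e * Y ^ x) (+-∸-assoc 1 (load≤ 𝒯 e))) (eq (X ^ load 𝒯 e) Y _)
      where
      eq : ∀ x y z → x * (y * z) ≡ y * (x * z)
      eq = solve-∀

    potential-[] : ∀ A → potential [] A ≤ m
    potential-[] A = ≤-trans (sum-mono-≤ {g = λ _ → 1} λ e → ≤-trans (≤-reflexive (*-identityˡ _)) (𝟙≤1 (A e)))
                      (≤-reflexive (trans (sum-const m 1) (*-identityʳ m)))

    weightOf≤ : ∀ {k} (𝒯 : Vec (Subset m) k) {A e} → A e ≡ true → weightOf 𝒯 e ≤ potential 𝒯 A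
    weightOf≤ 𝒯 {A} {e} Ae = ≤-trans (≤-reflexive (trans (sym (*-identityʳ _)) (cong (λ b → weightOf 𝒯 e * 𝟙 b) (sym Ae))))
      (fi≤sum (λ e → weightOf 𝒯 e * 𝟙 (A e)) e)

  exponent-split : ∀ x {k i j} → i ≤ j → j ≤ k → x ^ (k ∸ i) ≡ x ^ (j ∸ i) * x ^ (k ∸ j)
  exponent-split x {k} {i} {j} i≤j j≤k = trans (cong (x ^_) (sym eq)) (^-distribˡ-+-* x (j ∸ i) (k ∸ j))
    where
    eq : (j ∸ i) + (k ∸ j) ≡ k ∸ i
    eq = trans (+-comm (j ∸ i) (k ∸ j)) (trans (sym (+-∸-assoc (k ∸ j) i≤j)) (cong (_∸ i) (m∸n+n≡m j≤k)))

  weight-mono : ∀ {X Y i j k} → X ≤ Y → i ≤ j → j ≤ k → Y ^ i * X ^ (k ∸ i) ≤ Y ^ j * X ^ (k ∸ j)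
  weight-mono {X} {Y} {i} {j} {k} X≤Y i≤j j≤k = begin
    Y ^ i * X ^ (k ∸ i)                    ≡⟨ cong (Y ^ i *_) (exponent-split X i≤j j≤k) ⟩
    Y ^ i * (X ^ (j ∸ i) * X ^ (k ∸ j))    ≤⟨ *-monoʳ-≤ (Y ^ i) (*-monoˡ-≤ (X ^ (k ∸ j)) (^-monoˡ-≤ (j ∸ i) X≤Y)) ⟩
    Y ^ i * (Y ^ (j ∸ i) * X ^ (k ∸ j))    ≡⟨ sym (*-assoc (Y ^ i) _ _) ⟩
    Y ^ i * Y ^ (j ∸ i) * X ^ (k ∸ j)      ≡⟨ cong (_* X ^ (k ∸ j)) (sym (^-split Y i≤j)) ⟩
    Y ^ j * X ^ (k ∸ j)                    ∎
    where open ≤-Reasoning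

  weight-anti : ∀ {X Y i j k} → X ≤ Y → i ≤ j → j ≤ k → X ^ j * Y ^ (k ∸ j) ≤ X ^ i * Y ^ (k ∸ i)
  weight-anti {X} {Y} {i} {j} {k} X≤Y i≤j j≤k = begin
    X ^ j * Y ^ (k ∸ j)                    ≡⟨ cong (_* Y ^ (k ∸ j)) (^-split X i≤j) ⟩
    X ^ i * X ^ (j ∸ i) * Y ^ (k ∸ j)      ≡⟨ *-assoc (X ^ i) _ _ ⟩
    X ^ i * (X ^ (j ∸ i) * Y ^ (k ∸ j))    ≤⟨ *-monoʳ-≤ (X ^ i) (*-monoˡ-≤ (Y ^ (k ∸ j)) (^-monoˡ-≤ (j ∸ i) X≤Y)) ⟩
    X ^ i * (Y ^ (j ∸ i) * Y ^ (k ∸ j))    ≡⟨ cong (X ^ i *_) (sym (exponent-split Y i≤j j≤k)) ⟩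
    X ^ i * Y ^ (k ∸ i)                    ∎
    where open ≤-Reasoning

<ᵇ⁺ : ∀ {i j} → i < j → (i <ᵇ j) ≡ true
<ᵇ⁺ i<j = Equivalence.to Bool.T-≡ (<⇒<ᵇ i<j)

<ᵇ⁻ : ∀ {i j} → (i <ᵇ j) ≡ true → i < j
<ᵇ⁻ {i} {j} h = <ᵇ⇒< i j (Equivalence.from Bool.T-≡ h)

sum-pull : ∀ {m} c (f g : Fin m → ℕ) → sum (λ e → f e * (c * g e)) ≡ c * sum (λ e → f e * g e)
sum-pull c f g = trans (sum-cong-≗ λ e → eq (f e) c (g e)) (sym (*-distribˡ-sum c (λ e → f e * g e)))
  where
  eq : ∀ x y z → x * (y * z) ≡ y * (x * z)
  eq = solve-∀

sum-level : ∀ {m} c (H B : Fin m → Bool) → sum (λ e → 𝟙 (H e) * (c * 𝟙 (B e))) ≡ c * card (λ e → B e ∧ H e)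
sum-level c H B = trans (sum-pull c (𝟙 ∘ H) (𝟙 ∘ B)) (cong (c *_) (sum-cong-≗ λ e → 𝟙-∧ (H e) (B e)))
  where
  𝟙-∧ : ∀ h b → 𝟙 h * 𝟙 b ≡ 𝟙 (b ∧ h)
  𝟙-∧ true  true  = refl
  𝟙-∧ true  false = refl
  𝟙-∧ false true  = refl
  𝟙-∧ false false = refl

module LoadBounds {n m} (G : Multigraph n m) where
  open Multigraph G
  open Components G
  open Potential G

  module _ {k : ℕ} {tree : Subset m} {𝒯 : Vec (Subset m) k} (mst : IsMinimumSpanningTree (load 𝒯) tree) {ν p : ℕ} (D : Fin m → Bool) where

    -- A new tree multiplies the weights of its edges by `Y + δ` and all others by `Y`. Layer by
    -- layer, its edges in `D` hold at most a `p / ν` share of the potential, so the growth factor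
    -- is at most the value of the chord at `p`.
    upper-step : ∀ {Y δ h} .{{_ : NonZero ν}} →
      (∀ B → (∀ {e} → B e ≡ true → D e ≡ true) → objective ν p B ≤ objective ν p D) →
      ν * Y + p * δ ≤ ν * h →
      Growth.potential (Y + δ) Y (tree ∷ 𝒯) D ≤ h * Growth.potential (Y + δ) Y 𝒯 D
    upper-step {Y} {δ} {h} optimal rate = *-cancelˡ-≤ ν (begin
      ν * potential (tree ∷ 𝒯) D           ≡⟨ cong (ν *_) (trans (sum-cong-≗ pointwise) (∑-distrib-+ (λ e → W e * (Y * 𝟙 (D e))) (λ e → W e * (δ * 𝟙 (t e ∧ D e))))) ⟩
      ν * (sum (λ e → W e * (Y * 𝟙 (D e))) + sum (λ e → W e * (δ * 𝟙 (t e ∧ D e))))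
                                           ≡⟨ cong₂ (λ x y → ν * (x + y)) (sum-pull Y W (𝟙 ∘ D)) (sum-pull δ W (λ e → 𝟙 (t e ∧ D e))) ⟩
      ν * (Y * Φ + δ * S)                  ≡⟨ eq₁ ν Y Φ δ S ⟩
      ν * Y * Φ + δ * (ν * S)              ≤⟨ +-monoʳ-≤ (ν * Y * Φ) (*-monoʳ-≤ δ νS≤pΦ) ⟩
      ν * Y * Φ + δ * (p * Φ)              ≡⟨ eq₂ (ν * Y) p δ Φ ⟩
      (ν * Y + p * δ) * Φ                  ≤⟨ *-monoˡ-≤ Φ rate ⟩
      ν * h * Φ                            ≡⟨ *-assoc ν h Φ ⟩
      ν * (h * Φ)                          ∎)
      where
      open ≤-Reasoning
      open Growth (Y + δ) Y
      t : Fin m → Bool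
      t = lookup tree
      W : Fin m → ℕ
      W = weightOf 𝒯
      Φ S : ℕ
      Φ = potential 𝒯 D
      S = sum (λ e → W e * 𝟙 (t e ∧ D e))
      eq₁ : ∀ ν Y Φ δ S → ν * (Y * Φ + δ * S) ≡ ν * Y * Φ + δ * (ν * S)
      eq₁ = solve-∀
      eq₂ : ∀ x p δ Φ → x * Φ + δ * (p * Φ) ≡ (x + p * δ) * Φ
      eq₂ = solve-∀
      eq₃ : ∀ Y δ w d → (Y + δ) * w * d ≡ w * (Y * d) + w * (δ * d)
      eq₃ = solve-∀
      eq₄ : ∀ Y δ w d → Y * w * d ≡ w * (Y * d) + w * (δ * 0)
      eq₄ = solve-∀
      pointwise : ∀ e → weightOf (tree ∷ 𝒯) e * 𝟙 (D e) ≡ W e * (Y * 𝟙 (D e)) + W e * (δ * 𝟙 (t e ∧ D e))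
      pointwise e rewrite weightOf-∷ tree 𝒯 e with t e
      ... | true  = eq₃ Y δ (W e) (𝟙 (D e))
      ... | false = eq₄ Y δ (W e) (𝟙 (D e))
      νS≤pΦ : ν * S ≤ p * Φ
      νS≤pΦ = subst₂ _≤_ (sum-pull ν W (λ e → 𝟙 (t e ∧ D e))) (sum-pull p W (𝟙 ∘ D))
        (layer-cake W (λ e → ν * 𝟙 (t e ∧ D e)) (λ e → p * 𝟙 (D e)) λ s →
          subst₂ _≤_ (sym (sum-level ν (λ e → s <ᵇ W e) (λ e → t e ∧ D e))) (sym (sum-level p (λ e → s <ᵇ W e) D))
            (heavy-tree-edges mst {ν} {p} D (λ e → s <ᵇ W e) optimal λ {e} {f} s<We le →
              <ᵇ⁺ (<-≤-trans (<ᵇ⁻ s<We) (weight-mono (m≤m+n Y δ) le (load≤ 𝒯 f)))))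

    -- Now tree edges gain only the factor `X`, others `X + δ`, and the tree holds at least a
    -- `p / ν` share of the potential outside `D`. The resulting saving is added to both sides,
    -- since it cannot be subtracted in ℕ.
    lower-step : ∀ {X δ h} .{{_ : NonZero ν}} →
      (∀ B → (∀ {e} → D e ≡ true → B e ≡ true) → objective ν p B ≤ objective ν p D) →
      ν * (X + δ) ≤ ν * h + p * δ →
      Growth.potential X (X + δ) (tree ∷ 𝒯) (not ∘ D) ≤ h * Growth.potential X (X + δ) 𝒯 (not ∘ D)
    lower-step {X} {δ} {h} optimal rate = *-cancelˡ-≤ ν (+-cancelʳ-≤ (δ * (p * Φ)) _ _ (begin
      ν * Φ′ + δ * (p * Φ)                 ≤⟨ +-monoʳ-≤ (ν * Φ′) (*-monoʳ-≤ δ pΦ≤νS) ⟩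
      ν * Φ′ + δ * (ν * S)                 ≡⟨ eq₁ ν Φ′ δ S ⟩
      ν * (Φ′ + δ * S)                     ≡⟨ cong (ν *_) total ⟩
      ν * ((X + δ) * Φ)                    ≡⟨ sym (*-assoc ν (X + δ) Φ) ⟩
      ν * (X + δ) * Φ                      ≤⟨ *-monoˡ-≤ Φ rate ⟩
      (ν * h + p * δ) * Φ                  ≡⟨ eq₂ ν h p δ Φ ⟩
      ν * (h * Φ) + δ * (p * Φ)            ∎))
      where
      open ≤-Reasoning
      open Growth X (X + δ)
      t A : Fin m → Bool
      t = lookup tree
      A = not ∘ D
      W : Fin m → ℕ
      W = weightOf 𝒯
      Φ Φ′ S : ℕ
      Φ = potential 𝒯 A
      Φ′ = potential (tree ∷ 𝒯) A
      S = sum (λ e → W e * 𝟙 (t e ∧ A e))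
      eq₁ : ∀ ν Φ δ S → ν * Φ + δ * (ν * S) ≡ ν * (Φ + δ * S)
      eq₁ = solve-∀
      eq₂ : ∀ ν h p δ Φ → (ν * h + p * δ) * Φ ≡ ν * (h * Φ) + δ * (p * Φ)
      eq₂ = solve-∀
      eq₃ : ∀ X δ w d → X * w * d + w * (δ * d) ≡ w * ((X + δ) * d)
      eq₃ = solve-∀
      eq₄ : ∀ Y δ w d → Y * w * d + w * (δ * 0) ≡ w * (Y * d)
      eq₄ = solve-∀
      pointwise : ∀ e → weightOf (tree ∷ 𝒯) e * 𝟙 (A e) + W e * (δ * 𝟙 (t e ∧ A e)) ≡ W e * ((X + δ) * 𝟙 (A e))
      pointwise e rewrite weightOf-∷ tree 𝒯 e with t e
      ... | true  = eq₃ X δ (W e) (𝟙 (A e))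
      ... | false = eq₄ (X + δ) δ (W e) (𝟙 (A e))
      total : Φ′ + δ * S ≡ (X + δ) * Φ
      total = trans (cong (Φ′ +_) (sym (sum-pull δ W (λ e → 𝟙 (t e ∧ A e)))))
              (trans (sym (∑-distrib-+ (λ e → weightOf (tree ∷ 𝒯) e * 𝟙 (A e)) (λ e → W e * (δ * 𝟙 (t e ∧ A e)))))
              (trans (sum-cong-≗ pointwise) (sum-pull (X + δ) W (𝟙 ∘ A))))
      pΦ≤νS : p * Φ ≤ ν * S
      pΦ≤νS = subst₂ _≤_ (sum-pull p W (𝟙 ∘ A)) (sum-pull ν W (λ e → 𝟙 (t e ∧ A e)))
        (layer-cake W (λ e → p * 𝟙 (A e)) (λ e → ν * 𝟙 (t e ∧ A e)) λ s →
          subst₂ _≤_ (sym (sum-level p (λ e → s <ᵇ W e) A)) (sym (sum-level ν (λ e → s <ᵇ W e) (λ e → t e ∧ A e)))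
            -- Here the weight decreases with the load, so its superlevel sets consist of lightly
            -- loaded edges.
            (light-tree-edges mst {ν} {p} D (λ e → s <ᵇ W e) optimal λ {e} {f} s<We le →
              <ᵇ⁺ (<-≤-trans (<ᵇ⁻ s<We) (weight-anti (m≤m+n X δ) le (load≤ 𝒯 e)))))

  growth : ∀ {X Y h} (A : Fin m → Bool) →
    (∀ {k tree} {𝒯 : Vec (Subset m) k} → IsMinimumSpanningTree (load 𝒯) tree →
       Growth.potential X Y (tree ∷ 𝒯) A ≤ h * Growth.potential X Y 𝒯 A) →
    ∀ {k} {𝒯 : Vec (Subset m) k} → IsGreedy G 𝒯 → Growth.potential X Y 𝒯 A ≤ m * h ^ k
  growth {X} {Y} {h} A step [] = ≤-trans (Growth.potential-[] X Y A) (≤-reflexive (sym (*-identityʳ m)))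
  growth {X} {Y} {h} A step {suc k} (_∷_ {𝒯 = 𝒯} mst greedy) = ≤-trans (step {𝒯 = 𝒯} mst)
    (≤-trans (*-monoʳ-≤ h (growth {X} {Y} {h} A (λ {_} {_} {𝒯′} → step {𝒯 = 𝒯′}) greedy)) (≤-reflexive (eq h m (h ^ k))))
    where
    eq : ∀ x y z → x * (y * z) ≡ y * (x * z)
    eq = solve-∀

  module _ {N ν k} .{{_ : NonZero N}} .{{_ : NonZero ν}} {𝒯 : Vec (Subset m) k}
           (greedy : IsGreedy G 𝒯) (m^N≤2^k : m ^ N ≤ 2 ^ k) where

    private
      δ : ℕ
      δ = suc N ^ ν ∸ N ^ ν
      N+δ : suc N ^ ν ≡ N ^ ν + δ
      N+δ = sym (m+[n∸m]≡n (^-monoˡ-≤ ν (n≤1+n N)))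
      load≤k : ∀ e → load 𝒯 e ≤ k
      load≤k = Growth.load≤ 0 0 𝒯

    -- The weight of one edge is at most the whole potential, hence at most `m * h ^ k`. Of the two
    -- units added to `p`, one is the slack of the chord and the other the logarithmic excess.
    load-upper : ∀ {p} D → suc p * ν ≤ N →
      (∀ B → (∀ {e} → B e ≡ true → D e ≡ true) → objective ν p B ≤ objective ν p D) →
      ∀ {e} → D e ≡ true → ν * load 𝒯 e ≤ (2 + p) * k
    load-upper {p} D small optimal {e} De with <-≤-connex p ν
    -- The chord estimate needs `suc p ≤ ν`; otherwise `load ≤ k` is already strong enough.
    ... | inj₂ ν≤p = *-mono-≤ (≤-trans ν≤p (m≤n+m p 2)) (load≤k e)
    ... | inj₁ b≤ν with ≤-total (ν * load 𝒯 e) (suc p * k)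
    ...   | inj₁ le = ≤-trans le (m≤n+m (suc p * k) k)
    ...   | inj₂ bk≤νL = begin
      ν * L                       ≡⟨ sym (m∸n+n≡m bk≤νL) ⟩
      d + b * k                   ≤⟨ +-monoˡ-≤ (b * k) (logarithmic-excess {N} {d} {k} {m} (excess (b * k) v d {m} bound) m^N≤2^k) ⟩
      k + b * k                   ∎
      where
      open ≤-Reasoning
      open Growth (N ^ ν + δ) (N ^ ν)
      b L d v : ℕ
      b = suc p
      L = load 𝒯 e
      d = ν * L ∸ b * k
      v = ν * (k ∸ L)
      h : ℕ
      h = N ^ (ν ∸ b) * suc N ^ b
      exponent : (ν ∸ b) * k ≡ v + d
      exponent = trans (*-distribʳ-∸ k ν b) (trans (cong (_∸ b * k) (trans (cong (ν *_) (sym (m∸n+n≡m (load≤k e)))) (*-distribˡ-+ ν (k ∸ L) L))) (+-∸-assoc v bk≤νL))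
      hk : h ^ k ≡ N ^ (v + d) * suc N ^ (b * k)
      hk = trans (^-*-distrib (N ^ (ν ∸ b)) (suc N ^ b) k)
                 (cong₂ _*_ (trans (^-*-assoc N (ν ∸ b) k) (cong (N ^_) exponent)) (^-*-assoc (suc N) b k))
      we : weightOf 𝒯 e ≡ suc N ^ (b * k + d) * N ^ v
      we = cong₂ _*_ (trans (cong (_^ L) (sym N+δ)) (trans (^-*-assoc (suc N) ν L) (cong (suc N ^_) (sym (m+[n∸m]≡n bk≤νL)))))
                     (^-*-assoc N ν (k ∸ L))
      bound : suc N ^ (b * k + d) * N ^ v ≤ m * (N ^ (v + d) * suc N ^ (b * k))
      bound = subst₂ _≤_ we (cong (m *_) hk) (≤-trans (weightOf≤ 𝒯 De)
        (growth {N ^ ν + δ} {N ^ ν} {h} D (λ {_} {_} {𝒯′} mst → upper-step {𝒯 = 𝒯′} mst {ν} {p} D optimal (chord≤curve {p = p} b≤ν small N+δ)) greedy))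

    -- The critical load is `suc j`: the chord there lies below the curve at `j`, which costs one
    -- unit, and the logarithmic excess costs the other, the summand `k`.
    load-lower : ∀ {j} D → j ≤ ν → j * ν ≤ N →
      (∀ B → (∀ {e} → D e ≡ true → B e ≡ true) → objective ν (suc j) B ≤ objective ν (suc j) D) →
      ∀ {e} → D e ≡ false → j * k ≤ ν * load 𝒯 e + k
    load-lower {j} D j≤ν small optimal {e} ¬De with ≤-total (j * k) (ν * load 𝒯 e)
    ... | inj₁ le = ≤-trans le (m≤m+n _ k)
    ... | inj₂ νL≤jk = begin
      j * k                       ≡⟨ sym (m+[n∸m]≡n νL≤jk) ⟩
      ν * L + d                   ≤⟨ +-monoʳ-≤ (ν * L) (logarithmic-excess {N} {d} {k} {m} (excess u (ν * L) d {m} bound) m^N≤2^k) ⟩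
      ν * L + k                   ∎
      where
      open ≤-Reasoning
      open Growth (N ^ ν) (N ^ ν + δ)
      L d u : ℕ
      L = load 𝒯 e
      d = j * k ∸ ν * L
      u = (ν ∸ j) * k
      h : ℕ
      h = N ^ j * suc N ^ (ν ∸ j)
      exponent : ν * (k ∸ L) ≡ u + d
      exponent = trans (*-distribˡ-∸ ν k L) (trans (cong (_∸ ν * L) (trans (cong (_* k) (sym (m∸n+n≡m j≤ν))) (*-distribʳ-+ k (ν ∸ j) j))) (+-∸-assoc u νL≤jk))
      hk : h ^ k ≡ N ^ (ν * L + d) * suc N ^ u
      hk = trans (^-*-distrib (N ^ j) (suc N ^ (ν ∸ j)) k)
                 (cong₂ _*_ (trans (^-*-assoc N j k) (cong (N ^_) (sym (m+[n∸m]≡n νL≤jk)))) (^-*-assoc (suc N) (ν ∸ j) k))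
      we : weightOf 𝒯 e ≡ suc N ^ (u + d) * N ^ (ν * L)
      we = trans (cong₂ _*_ (^-*-assoc N ν L) (trans (cong (_^ (k ∸ L)) (sym N+δ)) (trans (^-*-assoc (suc N) ν (k ∸ L)) (cong (suc N ^_) exponent))))
                 (*-comm (N ^ (ν * L)) _)
      bound : suc N ^ (u + d) * N ^ (ν * L) ≤ m * (N ^ (ν * L + d) * suc N ^ u)
      bound = subst₂ _≤_ we (cong (m *_) hk) (≤-trans (weightOf≤ 𝒯 (cong not ¬De))
        (growth {N ^ ν} {N ^ ν + δ} {h} (not ∘ D) (λ {_} {_} {𝒯′} mst → lower-step {𝒯 = 𝒯′} mst {ν} {suc j} D optimal
          (≤-trans (≤-reflexive (cong (ν *_) (sym N+δ))) (chord≤curve′ {j = j} j≤ν small N+δ))) greedy))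

∣∣≡card : ∀ {m} (V : Subset m) → ∣ V ∣ ≡ card (lookup V)
∣∣≡card []          = refl
∣∣≡card (true  ∷ V) = cong suc (∣∣≡card V)
∣∣≡card (false ∷ V) = ∣∣≡card V

-- Cuts and dense edge sets

maximizer : ∀ {m} (g : Subset m → ℕ) → ∃[ V ] (∀ V′ → g V′ ≤ g V)
maximizer {zero}  g = [] , λ { [] → ≤-refl }
maximizer {suc m} g with maximizer (g ∘ (true ∷_)) | maximizer (g ∘ (false ∷_))
... | V , V-max | W , W-max with ≤-total (g (true ∷ V)) (g (false ∷ W))
...   | inj₁ le = false ∷ W , λ { (true ∷ V′) → ≤-trans (V-max V′) le ; (false ∷ V′) → W-max V′ }
...   | inj₂ ge = true ∷ V , λ { (true ∷ V′) → V-max V′ ; (false ∷ V′) → ≤-trans (W-max V′) ge }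

not-true : ∀ {b} → b ≢ true → b ≡ false
not-true {false} _ = refl
not-true {true}  h = contradiction refl h

module Cuts {n m} (G : Multigraph n m) where
  open Multigraph G
  open Components G
  open Potential G

  cross inner : (Fin n → Bool) → Fin m → Bool
  cross S e = S (end₁ e) xor S (end₂ e)
  inner S e = S (end₁ e) ∧ S (end₂ e)

  degree : (Fin n → Bool) → ℕ
  degree S = card (cross S)

  part : List (Fin m) → Fin n → Fin n → Bool
  part L r v = does (label L v Fin.≟ r)

  objective-cong : ∀ ν p {B C : Fin m → Bool} → (∀ e → B e ≡ C e) → objective ν p B ≡ objective ν p C
  objective-cong ν p {B} {C} B≗C = cong₂ (λ x y → ν * x + p * y)
    (cong #components (elements-cong B≗C)) (sum-cong-≗ λ e → cong 𝟙 (B≗C e))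

  optimum : ∀ ν p → ∃[ D ] (∀ B → objective ν p B ≤ objective ν p D)
  optimum ν p with maximizer (objective ν p ∘ lookup)
  ... | V , V-max = lookup V , λ B →
    ≤-trans (≤-reflexive (objective-cong ν p (λ e → sym (lookup∘tabulate B e)))) (V-max (tabulate B))

  -- Adding a spanned edge would keep the components and raise the objective by `p`. So `D` contains
  -- every edge within each of its components.
  optimum-closed : ∀ {ν p D} .{{_ : NonZero p}} → (∀ B → objective ν p B ≤ objective ν p D) →
                   ∀ {e} → Spans (elements D) e → D e ≡ true
  optimum-closed {ν} {p} {D} optimal {e} s = decidable-stable (D e Bool.≟ true) λ De≢true →
    <⇒≱ (grows (not-true De≢true)) (optimal B)
    where
    B H : Fin m → Bool
    B x = D x ∨ does (e Fin.≟ x)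
    H x = not (D x) ∧ does (e Fin.≟ x)
    spanned : ∀ {x} → x ∈ˡ elements B → Spans (elements D) x
    spanned {x} x∈ with D x in Dx | e Fin.≟ x | ∈-elements⁻ B x∈
    ... | true  | _        | _ = spans-member (∈-elements⁺ D Dx)
    ... | false | yes refl | _ = s
    ... | false | no  _    | ()
    grows : D e ≡ false → objective ν p D < objective ν p B
    grows ¬De = +-mono-≤-< (*-monoʳ-≤ ν (#components-antitone (elements B) (elements D) spanned))
      (*-monoʳ-< p (subst (card D <_) (sym (card-∨ D (λ x → does (e Fin.≟ x))))
        (m<m+n (card D) (≤-trans (≤-reflexive (sym He)) (fi≤sum (𝟙 ∘ H) e)))))
      where
      He : 𝟙 (H e) ≡ 1
      He = cong₂ (λ x y → 𝟙 (not x ∧ y)) ¬De (dec-true (e Fin.≟ e) refl)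

  ProperPart : (Fin n → Bool) → (Fin n → Bool) → Set
  ProperPart X Y = ∃[ y ] Y y ≡ true × (∀ {v} → Y v ≡ true → X v ≡ true) × ∃[ x ] (X x ≡ true × Y x ≡ false)

  module _ (X : Fin n → Bool) (B : Fin m → Bool) (B⊆X : ∀ {e} → B e ≡ true → inner X e ≡ true) where
    private
      L : List (Fin m)
      L = elements B
      WithinX : List (Fin m) → Set
      WithinX L = ∀ {e} → e ∈ˡ L → inner X e ≡ true

    label-stays : ∀ L → WithinX L → ∀ v → X (label L v) ≡ X v
    label-stays []      w v = refl
    label-stays (e ∷ L) w v with label L v Fin.≟ label L (end₁ e)
    ... | no _  = label-stays L (w ∘ there) v
    ... | yes p = trans (trans (label-stays L (w ∘ there) (end₂ e)) (proj₂ ends))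
                  (sym (trans (sym (label-stays L (w ∘ there) v)) (trans (cong X p) (trans (label-stays L (w ∘ there) (end₁ e)) (proj₁ ends)))))
      where
      ends : X (end₁ e) ≡ true × X (end₂ e) ≡ true
      ends = ∧-splits (w (here refl))

    label-outside : ∀ L → WithinX L → ∀ {v} → X v ≡ false → label L v ≡ v
    label-outside []      w ¬Xv = refl
    label-outside (e ∷ L) w {v} ¬Xv with label L v Fin.≟ label L (end₁ e)
    ... | no _  = label-outside L (w ∘ there) ¬Xv
    ... | yes p = contradiction
      (trans (sym ¬Xv) (trans (sym (label-stays L (w ∘ there) v)) (trans (cong X p) (trans (label-stays L (w ∘ there) (end₁ e)) (proj₁ (∧-splits (w (here refl))))))))
      λ ()

    rootsIn : ℕ
    rootsIn = card (λ r → isRoot L r ∧ X r)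

    within : WithinX L
    within = B⊆X ∘ ∈-elements⁻ B

    #components-split : #components L ≡ card (not ∘ X) + rootsIn
    #components-split = trans (card-split (isRoot L) X) (cong (_+ rootsIn) (sum-cong-≗ λ r → cong 𝟙 (outside-root r)))
      where
      outside-root : ∀ r → isRoot L r ∧ not (X r) ≡ not (X r)
      outside-root r with X r in Xr
      ... | true  = Bool.∧-zeroʳ _
      ... | false = cong (_∧ true) (dec-true (label L r Fin.≟ r) (label-outside L within Xr))

    -- An edge contributes at most once for each of its ends in `X`, and nothing if it belongs to
    -- `B`, because its ends then share a component.
    degree-sum : sum (λ r → 𝟙 (isRoot L r ∧ X r) * degree (part L r)) ≤
                 2 * card (λ e → inner X e ∧ not (B e)) + degree X
    degree-sum = begin
      sum (λ r → 𝟙 (isRoot L r ∧ X r) * degree (part L r))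
        ≡⟨ sum-cong-≗ (λ r → *-distribˡ-sum (𝟙 (isRoot L r ∧ X r)) (𝟙 ∘ cross (part L r))) ⟩
      sum (λ r → sum λ e → 𝟙 (isRoot L r ∧ X r) * 𝟙 (cross (part L r) e))
        ≡⟨ ∑-comm (λ r e → 𝟙 (isRoot L r ∧ X r) * 𝟙 (cross (part L r) e)) ⟩
      sum (λ e → sum λ r → 𝟙 (isRoot L r ∧ X r) * 𝟙 (cross (part L r) e))
        ≤⟨ sum-mono-≤ per-edge ⟩
      sum (λ e → 2 * 𝟙 (inner X e ∧ not (B e)) + 𝟙 (cross X e))
        ≡⟨ ∑-distrib-+ (λ e → 2 * 𝟙 (inner X e ∧ not (B e))) (𝟙 ∘ cross X) ⟩
      sum (λ e → 2 * 𝟙 (inner X e ∧ not (B e))) + degree X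
        ≡⟨ cong (_+ degree X) (sym (*-distribˡ-sum 2 (λ e → 𝟙 (inner X e ∧ not (B e))))) ⟩
      2 * card (λ e → inner X e ∧ not (B e)) + degree X ∎
      where
      open ≤-Reasoning
      term : ∀ i x a b → 𝟙 (i ∧ x) * 𝟙 (a xor b) ≤ 𝟙 a * 𝟙 x + 𝟙 b * 𝟙 x
      term false x     a     b     = z≤n
      term true  false a     b     = z≤n
      term true  true  true  true  = z≤n
      term true  true  true  false = ≤-refl
      term true  true  false true  = ≤-refl
      term true  true  false false = z≤n
      ends : ∀ a b → 𝟙 a + 𝟙 b ≤ 2 * 𝟙 ((a ∧ b) ∧ true) + 𝟙 (a xor b)
      ends true  true  = ≤-refl
      ends true  false = ≤-refl
      ends false true  = ≤-refl
      ends false false = ≤-refl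
      spanned-edge : ∀ {a b} → a ≡ b → ∀ r → 𝟙 (isRoot L r ∧ X r) * 𝟙 (does (a Fin.≟ r) xor does (b Fin.≟ r)) ≤ 0
      spanned-edge {a} refl r = ≤-reflexive (trans (cong (λ b → 𝟙 (isRoot L r ∧ X r) * 𝟙 b) (Bool.xor-same (does (a Fin.≟ r)))) (*-zeroʳ (𝟙 (isRoot L r ∧ X r))))
      per-edge : ∀ e → sum (λ r → 𝟙 (isRoot L r ∧ X r) * 𝟙 (cross (part L r) e)) ≤ 2 * 𝟙 (inner X e ∧ not (B e)) + 𝟙 (cross X e)
      per-edge e with B e in Be
      ... | true = ≤-trans (sum-mono-≤ {g = λ _ → 0} (spanned-edge (spans-member (∈-elements⁺ B Be)))) (≤-trans (≤-reflexive (sum-0 n)) z≤n)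
      ... | false = begin
        sum (λ r → 𝟙 (isRoot L r ∧ X r) * 𝟙 (cross (part L r) e))
          ≤⟨ sum-mono-≤ (λ r → term (isRoot L r) (X r) (does (la Fin.≟ r)) (does (lb Fin.≟ r))) ⟩
        sum (λ r → 𝟙 (does (la Fin.≟ r)) * 𝟙 (X r) + 𝟙 (does (lb Fin.≟ r)) * 𝟙 (X r))
          ≡⟨ ∑-distrib-+ (λ r → 𝟙 (does (la Fin.≟ r)) * 𝟙 (X r)) (λ r → 𝟙 (does (lb Fin.≟ r)) * 𝟙 (X r)) ⟩
        sum (λ r → 𝟙 (does (la Fin.≟ r)) * 𝟙 (X r)) + sum (λ r → 𝟙 (does (lb Fin.≟ r)) * 𝟙 (X r))
          ≡⟨ cong₂ _+_ (sum-δ la (𝟙 ∘ X)) (sum-δ lb (𝟙 ∘ X)) ⟩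
        𝟙 (X la) + 𝟙 (X lb)
          ≡⟨ cong₂ (λ x y → 𝟙 x + 𝟙 y) (label-stays L within (end₁ e)) (label-stays L within (end₂ e)) ⟩
        𝟙 (X (end₁ e)) + 𝟙 (X (end₂ e))
          ≤⟨ ends (X (end₁ e)) (X (end₂ e)) ⟩
        2 * 𝟙 (inner X e ∧ true) + 𝟙 (cross X e) ∎
        where
        la = label L (end₁ e)
        lb = label L (end₂ e)

    roots≤degrees : ∀ {μ} → (∀ {r} → isRoot L r ≡ true → X r ≡ true → μ ≤ degree (part L r)) →
                    μ * rootsIn ≤ 2 * card (λ e → inner X e ∧ not (B e)) + degree X
    roots≤degrees {μ} large = begin
      μ * rootsIn                                            ≡⟨ *-distribˡ-sum μ (λ r → 𝟙 (isRoot L r ∧ X r)) ⟩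
      sum (λ r → μ * 𝟙 (isRoot L r ∧ X r))                   ≤⟨ sum-mono-≤ le ⟩
      sum (λ r → 𝟙 (isRoot L r ∧ X r) * degree (part L r))   ≤⟨ degree-sum ⟩
      2 * card (λ e → inner X e ∧ not (B e)) + degree X      ∎
      where
      open ≤-Reasoning
      le : ∀ r → μ * 𝟙 (isRoot L r ∧ X r) ≤ 𝟙 (isRoot L r ∧ X r) * degree (part L r)
      le r with isRoot L r in root | X r in Xr
      ... | true  | true  = ≤-trans (≤-reflexive (*-identityʳ μ)) (≤-trans (large root Xr) (m≤m+n _ 0))
      ... | true  | false = ≤-reflexive (*-zeroʳ μ)
      ... | false | _     = ≤-reflexive (*-zeroʳ μ)

    -- If `B` leaves `X` in one piece, the summand `μ` alone suffices. Otherwise every piece is a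
    -- proper part of `X` and has degree at least `μ`.
    roots≤proper-degrees : ∀ {μ} → degree X ≤ μ → (∀ Y → ProperPart X Y → μ ≤ degree Y) →
                           μ * rootsIn ≤ 2 * card (λ e → inner X e ∧ not (B e)) + μ
    roots≤proper-degrees {μ} dX≤μ large with rootsIn ≤? 1
    ... | yes ≤1 = ≤-trans (≤-trans (*-monoʳ-≤ μ ≤1) (≤-reflexive (*-identityʳ μ))) (m≤n+m μ _)
    ... | no  ≰1 = ≤-trans (roots≤degrees proper) (+-monoʳ-≤ (2 * card (λ e → inner X e ∧ not (B e))) dX≤μ)
      where
      proper : ∀ {r} → isRoot L r ≡ true → X r ≡ true → μ ≤ degree (part L r)
      proper {r} root Xr with Fin.any? (λ x → (X x Bool.≟ true) ×-dec (part L r x Bool.≟ false))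
      ... | yes (x , Xx , ¬px) = large (part L r) (r , root , (λ {v} pv → trans (sym (label-stays L within v)) (trans (cong X (does⇒ _ _ pv)) Xr)) , x , Xx , ¬px)
      ... | no none = contradiction (sum-𝟙≤1 (λ x → isRoot L x ∧ X x) λ i j pi pj → trans (only pi) (sym (only pj))) ≰1
        where
        only : ∀ {i} → isRoot L i ∧ X i ≡ true → i ≡ r
        only {i} pi with ∧-splits {isRoot L i} pi | part L r i in pr
        ... | _ , Xi    | false = contradiction (i , Xi , pr) none
        ... | root′ , _ | true  = trans (sym (does⇒ (label L i) i root′)) (does⇒ (label L i) r pr)

  -- Deleting `d` inner edges and thereby cutting `X` into `r` pieces requires
  -- `μ * (r - 1) ≤ 2 * d`, by counting degrees. With `2 * ν ≤ p * μ`, the gain `ν * (r - 1)` is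
  -- then at most the loss `p * d`. Large cuts thus certify the critical load `p / ν`, roughly
  -- `2 / μ`, for the edges inside `X`.
  inner-optimal : ∀ {ν p μ} .{{_ : NonZero μ}} (X : Fin n → Bool) {x} → X x ≡ true → 2 * ν ≤ p * μ → degree X ≤ μ →
    (∀ Y → ProperPart X Y → μ ≤ degree Y) →
    ∀ B → (∀ {e} → B e ≡ true → inner X e ≡ true) → objective ν p B ≤ objective ν p (inner X)
  inner-optimal {ν} {p} {μ} X {x} Xx 2ν≤pμ dX≤μ large B B⊆ = *-cancelˡ-≤ μ (begin
    μ * (ν * c B + p * card B)                        ≡⟨ cong (λ z → μ * (ν * z + p * card B)) (#components-split X B B⊆) ⟩
    μ * (ν * (o + rB) + p * card B)                   ≡⟨ eq₁ μ ν o rB (p * card B) ⟩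
    ν * (μ * rB) + μ * (ν * o + p * card B)           ≤⟨ +-monoˡ-≤ (μ * (ν * o + p * card B)) (*-monoʳ-≤ ν (roots≤proper-degrees X B B⊆ dX≤μ large)) ⟩
    ν * (2 * d + μ) + μ * (ν * o + p * card B)        ≡⟨ eq₂ ν d μ o (p * card B) ⟩
    2 * ν * d + μ * (ν * (o + 1) + p * card B)        ≤⟨ +-mono-≤ (*-monoˡ-≤ d 2ν≤pμ) (*-monoʳ-≤ μ (+-monoˡ-≤ (p * card B) (*-monoʳ-≤ ν (+-monoʳ-≤ o rD≥1)))) ⟩
    p * μ * d + μ * (ν * (o + rD) + p * card B)       ≡⟨ eq₃ p μ d (ν * (o + rD)) (card B) ⟩
    μ * (ν * (o + rD) + p * (d + card B))             ≡⟨ cong₂ (λ y z → μ * (ν * y + p * z)) (sym (#components-split X D id)) (sym card-D) ⟩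
    μ * (ν * c D + p * card D)                        ∎)
    where
    open ≤-Reasoning
    D : Fin m → Bool
    D = inner X
    c : (Fin m → Bool) → ℕ
    c B = #components (elements B)
    o rB rD d : ℕ
    o = card (not ∘ X)
    rB = rootsIn X B B⊆
    rD = rootsIn X D id
    d = card (λ e → D e ∧ not (B e))
    eq₁ : ∀ μ ν o r b → μ * (ν * (o + r) + b) ≡ ν * (μ * r) + μ * (ν * o + b)
    eq₁ = solve-∀
    eq₂ : ∀ ν d μ o b → ν * (2 * d + μ) + μ * (ν * o + b) ≡ 2 * ν * d + μ * (ν * (o + 1) + b)
    eq₂ = solve-∀
    eq₃ : ∀ p μ d x b → p * μ * d + μ * (x + p * b) ≡ μ * (x + p * (d + b))
    eq₃ = solve-∀
    rD≥1 : 1 ≤ rD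
    rD≥1 = ≤-trans (≤-reflexive (sym (cong 𝟙 (cong₂ _∧_ (isRoot-label (elements D) x) (trans (label-stays X D id (elements D) (∈-elements⁻ D) x) Xx)))))
                   (fi≤sum (λ r → 𝟙 (isRoot (elements D) r ∧ X r)) (label (elements D) x))
    card-D : card D ≡ d + card B
    card-D = trans (card-split D B) (cong (d +_) (sum-cong-≗ λ e → cong 𝟙 (both e)))
      where
      both : ∀ e → D e ∧ B e ≡ B e
      both e with B e in Be
      ... | true  = cong (_∧ true) (B⊆ Be)
      ... | false = Bool.∧-zeroʳ (D e)

  #components≥1 : Fin n → ∀ L → 1 ≤ #components L
  #components≥1 x L = ≤-trans (≤-reflexive (sym (cong 𝟙 (isRoot-label L x)))) (fi≤sum (𝟙 ∘ isRoot L) (label L x))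

  full : Fin n → Bool
  full _ = true

  degree-full : degree full ≡ 0
  degree-full = sum-0 m

  all-edges-optimal : ∀ {ν p μ} .{{_ : NonZero μ}} → Fin n → 2 * ν ≤ p * μ →
    (∀ Y → ProperPart full Y → μ ≤ degree Y) →
    ∀ B → (∀ {e} → B e ≡ true → true ≡ true) → objective ν p B ≤ objective ν p (λ _ → true)
  all-edges-optimal {ν} {p} {μ} x 2ν≤pμ large B _ =
    inner-optimal {ν} {p} {μ} full {x} refl 2ν≤pμ (≤-trans (≤-reflexive degree-full) z≤n) large B (λ _ → refl)

  -- If all `c` components had degree at least `μ`, then at least `μ * c / 2` edges would be missing
  -- from `D`. Adding all of them would gain at least `ν * c` and lose at most `ν * (c - 1)`.
  small-part : ∀ {ν p μ D} .{{_ : NonZero ν}} → Fin n → 2 * ν ≤ p * μ →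
    (∀ B → objective ν p B ≤ objective ν p D) →
    ∃[ r ] (isRoot (elements D) r ≡ true × degree (part (elements D) r) < μ)
  small-part {ν} {p} {μ} {D} x 2ν≤pμ optimal
    with Fin.any? (λ r → (isRoot (elements D) r Bool.≟ true) ×-dec (degree (part (elements D) r) <? μ))
  ... | yes found = found
  ... | no none = contradiction (begin-strict
    2 * (ν * c)                             <⟨ m<m+n (2 * (ν * c)) (≤-trans (>-nonZero⁻¹ ν) (m≤n*m ν 2)) ⟩
    2 * (ν * c) + 2 * ν                     ≡⟨ eq₁ ν c ⟩
    2 * ν * c + 2 * ν                       ≤⟨ +-monoˡ-≤ (2 * ν) (*-monoˡ-≤ c 2ν≤pμ) ⟩
    p * μ * c + 2 * ν                       ≡⟨ cong (_+ 2 * ν) (*-assoc p μ c) ⟩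
    p * (μ * c) + 2 * ν                     ≤⟨ +-monoˡ-≤ (2 * ν) (*-monoʳ-≤ p μc≤2d) ⟩
    p * (2 * d) + 2 * ν                     ≡⟨ eq₂ p d ν ⟩
    2 * (ν * 1 + p * d)                     ≤⟨ *-monoʳ-≤ 2 (+-cancelʳ-≤ (p * card D) _ _ optimal-all) ⟩
    2 * (ν * c)                             ∎) (<-irrefl refl)
    where
    open ≤-Reasoning
    c d : ℕ
    c = #components (elements D)
    d = card (not ∘ D)
    eq₁ : ∀ ν c → 2 * (ν * c) + 2 * ν ≡ 2 * ν * c + 2 * ν
    eq₁ = solve-∀
    eq₂ : ∀ p d ν → p * (2 * d) + 2 * ν ≡ 2 * (ν * 1 + p * d)
    eq₂ = solve-∀
    eq₃ : ∀ x p d D → x + p * d + p * D ≡ x + p * (D + d)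
    eq₃ = solve-∀
    all : Fin m → Bool
    all _ = true
    optimal-all : ν * 1 + p * d + p * card D ≤ ν * c + p * card D
    optimal-all = begin
      ν * 1 + p * d + p * card D            ≡⟨ eq₃ (ν * 1) p d (card D) ⟩
      ν * 1 + p * (card D + d)              ≤⟨ +-monoˡ-≤ (p * (card D + d)) (*-monoʳ-≤ ν (#components≥1 x (elements all))) ⟩
      ν * #components (elements all) + p * (card D + d)
                                            ≡⟨ cong (λ y → ν * #components (elements all) + p * y) (sym card-all) ⟩
      objective ν p all                     ≤⟨ optimal all ⟩
      ν * c + p * card D                    ∎
      where
      card-all : card all ≡ card D + d
      card-all = trans (sum-cong-≗ λ e → split (D e)) (∑-distrib-+ (𝟙 ∘ D) (𝟙 ∘ not ∘ D))
        where
        split : ∀ b → 1 ≡ 𝟙 b + 𝟙 (not b)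
        split true  = refl
        split false = refl
    μc≤2d : μ * c ≤ 2 * d
    μc≤2d = begin
      μ * c                                 ≡⟨ cong (μ *_) (sum-cong-≗ λ r → cong 𝟙 (sym (Bool.∧-identityʳ (isRoot (elements D) r)))) ⟩
      μ * rootsIn full D (λ _ → refl)       ≤⟨ roots≤degrees full D (λ _ → refl) {μ} (λ {r} root _ → ≮⇒≥ λ lt → none (r , root , lt)) ⟩
      2 * d + degree full                   ≡⟨ cong (2 * d +_) degree-full ⟩
      2 * d + 0                             ≡⟨ +-identityʳ _ ⟩
      2 * d                                 ∎

  ∣crossing∣ : ∀ S → ∣ crossing S ∣ ≡ degree (lookup S)
  ∣crossing∣ S = trans (∣∣≡card (crossing S)) (sum-cong-≗ λ e → cong 𝟙 (lookup∘tabulate (cross (lookup S)) e))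

  degree-cong : ∀ {S S′} → (∀ v → S v ≡ S′ v) → degree S ≡ degree S′
  degree-cong eq = sum-cong-≗ λ e → cong₂ (λ a b → 𝟙 (a xor b)) (eq (end₁ e)) (eq (end₂ e))

  degree-tabulate : ∀ S → ∣ crossing (tabulate S) ∣ ≡ degree S
  degree-tabulate S = trans (∣crossing∣ (tabulate S)) (degree-cong {lookup (tabulate S)} {S} (lookup∘tabulate S))

  not-crossed : ∀ {F : Fin m → Set} {S : Fin n → Bool} {u v ss} →
                (∀ {e} → F e → S (end₁ e) ≡ S (end₂ e)) → Walk F u ss v → S u ≡ S v
  not-crossed s [] = refl
  not-crossed s ((p , inj₁ (refl , refl)) ∷ ws) = trans (s p) (not-crossed s ws)
  not-crossed s ((p , inj₂ (refl , refl)) ∷ ws) = trans (sym (s p)) (not-crossed s ws)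

  xor-false : ∀ {a b} → a xor b ≢ true → a ≡ b
  xor-false {true}  {true}  h = refl
  xor-false {true}  {false} h = contradiction refl h
  xor-false {false} {true}  h = contradiction refl h
  xor-false {false} {false} h = refl

  module _ {lam} (minCutValue : IsMinCutValue lam) where

    degree≥ : ∀ S {x y} → S x ≡ true → S y ≡ false → lam ≤ degree S
    degree≥ S {x} {y} Sx Sy = ≤-trans (proj₂ minCutValue (crossing (tabulate S)) disconnects) (≤-reflexive (degree-tabulate S))
      where
      disconnects : Disconnects (crossing (tabulate S))
      disconnects conn = contradiction
        (trans (sym Sx) (trans (not-crossed {S = S} uncrossed (proj₂ (conn x y))) Sy)) λ ()
        where
        uncrossed : ∀ {e} → ¬ (e ∈ˢ crossing (tabulate S)) → S (end₁ e) ≡ S (end₂ e)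
        uncrossed {e} e∉ = xor-false λ p → e∉ (lookup⇒[]= e (crossing (tabulate S))
          (trans (lookup∘tabulate (cross (lookup (tabulate S))) e) (trans (cong₂ _xor_ (lookup∘tabulate S (end₁ e)) (lookup∘tabulate S (end₂ e))) p)))

    -- A component left after deleting a disconnecting set is one side of a cut whose crossing edges
    -- all belong to that set.
    minCut : ∃[ S ] ∃[ x ] ∃[ y ] (S x ≡ true × S y ≡ false × degree S ≤ lam)
    minCut = let F , disconnects , ∣F∣≡lam = proj₁ minCutValue
                 S , x , y , Sx , Sy , dS≤ = separate F disconnects
             in S , x , y , Sx , Sy , ≤-trans dS≤ (≤-reflexive ∣F∣≡lam)
      where
      separate : ∀ F → Disconnects F → ∃[ S ] ∃[ x ] ∃[ y ] (S x ≡ true × S y ≡ false × degree S ≤ ∣ F ∣)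
      separate F disconnects with Fin.any? (λ u → Fin.any? (λ v → part L (label L u) v Bool.≟ false))
        where
        L : List (Fin m)
        L = elements (not ∘ lookup F)
      ... | no none = contradiction connected disconnects
        where
        L : List (Fin m)
        L = elements (not ∘ lookup F)
        keep : ∀ {e} → e ∈ˡ L → ¬ (e ∈ˢ F)
        keep {e} e∈ e∈F = contradiction (trans (sym (∈-elements⁻ (not ∘ lookup F) e∈)) (cong not ([]=⇒lookup e∈F))) λ ()
        connected : ConnectedVia (λ e → ¬ (e ∈ˢ F))
        connected u v = label⇒reachable L keep (sym
          (does⇒ (label L v) (label L u) (decidable-stable (part L (label L u) v Bool.≟ true) λ p → none (u , v , not-true p))))
      ... | yes (u , y , ¬Sy) = S , u , y , dec-true (label L u Fin.≟ label L u) refl , ¬Sy ,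
        ≤-trans (sum-mono-≤ λ e → 𝟙-mono (crossed e)) (≤-reflexive (sym (∣∣≡card F)))
        where
        L : List (Fin m)
        L = elements (not ∘ lookup F)
        S : Fin n → Bool
        S = part L (label L u)
        crossed : ∀ e → cross S e ≡ true → lookup F e ≡ true
        crossed e crosses with lookup F e in Fe
        ... | true  = refl
        ... | false = contradiction (trans (sym crosses) (trans
          (cong (λ x → does (x Fin.≟ label L u) xor S (end₂ e)) (spans-member {L} (∈-elements⁺ (not ∘ lookup F) (cong not Fe))))
          (Bool.xor-same (S (end₂ e))))) λ ()

-- The threshold over the integers

toℚᵘ-/ : ∀ i d .{{_ : NonZero d}} → ℚ.toℚᵘ (i ℚ./ d) ≃ i ℚᵘ./ d
toℚᵘ-/ i (suc d) = ℚ.toℚᵘ-fromℚᵘ (mkℚᵘ i d)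

module _ (l : ℕ) where
  private
    lam d : ℕ
    lam = suc l
    d = 2 * lam ^ 2
    instance
      d≢0 : NonZero d
      d≢0 = m*n≢0 2 (lam ^ 2) {{_}} {{m^n≢0 lam 2}}

  toℚᵘ-threshold : ℚ.toℚᵘ (threshold lam) ≃ ((ℤ.+ 2) ℚᵘ./ lam) ℚᵘ.- ((ℤ.+ 1) ℚᵘ./ d)
  toℚᵘ-threshold = ℚᵘ.≃-trans (ℚ.toℚᵘ-homo-+ ((ℤ.+ 2) ℚ./ lam) (ℚ.- ((ℤ.+ 1) ℚ./ d)))
    (ℚᵘ.+-cong (toℚᵘ-/ (ℤ.+ 2) lam) (ℚᵘ.≃-trans (ℚ.toℚᵘ-homo‿- ((ℤ.+ 1) ℚ./ d)) (ℚᵘ.-‿cong (toℚᵘ-/ (ℤ.+ 1) d))))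

private
  below⁺ : ∀ L K B C → L * K + B < C → ℤ.+ L ℤ.* ℤ.+ K ℤ.< ℤ.+ C ℤ.- ℤ.+ B
  below⁺ L K B C lt = subst₂ ℤ._<_ (trans (cong (ℤ._- ℤ.+ B) (ℤ.pos-+ (L * K) B)) (trans (eq (ℤ.+ (L * K)) (ℤ.+ B)) (ℤ.pos-* L K))) refl
    (ℤ.+-monoˡ-< (ℤ.- (ℤ.+ B)) (+<+ lt))
    where
    eq : ∀ x y → (x ℤ.+ y) ℤ.- y ≡ x
    eq = ℤ-solve-∀

  below⁻ : ∀ L K B C → ℤ.+ L ℤ.* ℤ.+ K ℤ.< ℤ.+ C ℤ.- ℤ.+ B → L * K + B < C
  below⁻ L K B C lt = ℤ.drop‿+<+ (subst₂ ℤ._<_ (trans (cong (ℤ._+ ℤ.+ B) (sym (ℤ.pos-* L K))) (sym (ℤ.pos-+ (L * K) B))) (eq (ℤ.+ C) (ℤ.+ B))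
    (ℤ.+-monoˡ-< (ℤ.+ B) lt))
    where
    eq : ∀ x y → (x ℤ.- y) ℤ.+ y ≡ x
    eq = ℤ-solve-∀

  fraction⇔ : ∀ L k l d → 
    ((L * (suc l * suc d) + suc l * suc k < 2 * suc d * suc k) → mkℚᵘ (ℤ.+ L) k ℚᵘ.< mkℚᵘ (ℤ.+ 2) l ℚᵘ.- mkℚᵘ (ℤ.+ 1) d) ×
    (mkℚᵘ (ℤ.+ L) k ℚᵘ.< mkℚᵘ (ℤ.+ 2) l ℚᵘ.- mkℚᵘ (ℤ.+ 1) d → (L * (suc l * suc d) + suc l * suc k < 2 * suc d * suc k))
  fraction⇔ L k l d = (λ h → *<* (subst (ℤ.+ L ℤ.* ℤ.+ (suc l * suc d) ℤ.<_) (sym rhs) (below⁺ L (suc l * suc d) (suc l * suc k) (2 * suc d * suc k) h)))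
                    , (λ { (*<* h) → below⁻ L (suc l * suc d) (suc l * suc k) (2 * suc d * suc k) (subst (ℤ.+ L ℤ.* ℤ.+ (suc l * suc d) ℤ.<_) rhs h) })
    where
    eq : ∀ x y z → (ℤ.+ 2 ℤ.* x ℤ.+ ℤ.- (ℤ.+ 1) ℤ.* y) ℤ.* z ≡ ℤ.+ 2 ℤ.* x ℤ.* z ℤ.- y ℤ.* z
    eq = ℤ-solve-∀
    rhs : (ℤ.+ 2 ℤ.* ℤ.+ suc d ℤ.+ ℤ.- (ℤ.+ 1) ℤ.* ℤ.+ suc l) ℤ.* ℤ.+ suc k ≡ ℤ.+ (2 * suc d * suc k) ℤ.- ℤ.+ (suc l * suc k)
    rhs = trans (eq (ℤ.+ suc d) (ℤ.+ suc l) (ℤ.+ suc k)) (cong₂ ℤ._-_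
      (trans (cong (ℤ._* ℤ.+ suc k) (sym (ℤ.pos-* 2 (suc d)))) (sym (ℤ.pos-* (2 * suc d) (suc k)))) (sym (ℤ.pos-* (suc l) (suc k))))

module _ (l L k : ℕ) where
  private
    lam : ℕ
    lam = suc l
    eq₁ : ∀ lam L k → lam * (2 * (lam * lam) * L + k) ≡ L * (lam * (2 * (lam * (lam * 1)))) + lam * k
    eq₁ = solve-∀
    eq₂ : ∀ lam k → lam * (4 * lam * k) ≡ 2 * (2 * (lam * (lam * 1))) * k
    eq₂ = solve-∀

  -- Subtracting the two fractions unreduced gives the denominator `lam * (2 * lam ^ 2)`; the
  -- comparison obtained that way is this one multiplied by `lam`.
  below-threshold⁺ : 2 * (lam * lam) * L + suc k < 4 * lam * suc k → (ℤ.+ L) ℚ./ suc k ℚ.< threshold lam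
  below-threshold⁺ h = ℚ.toℚᵘ-cancel-< (ℚᵘ.<-respˡ-≃ (ℚᵘ.≃-sym (toℚᵘ-/ (ℤ.+ L) (suc k))) (ℚᵘ.<-respʳ-≃ (ℚᵘ.≃-sym (toℚᵘ-threshold l))
    (proj₁ (fraction⇔ L k l (pred (2 * lam ^ 2))) (subst₂ _<_ (eq₁ lam L (suc k)) (eq₂ lam (suc k)) (*-monoʳ-< lam h)))))

  below-threshold⁻ : (ℤ.+ L) ℚ./ suc k ℚ.< threshold lam → 2 * (lam * lam) * L + suc k < 4 * lam * suc k
  below-threshold⁻ h = *-cancelˡ-< lam _ _ (subst₂ _<_ (sym (eq₁ lam L (suc k))) (sym (eq₂ lam (suc k)))
    (proj₂ (fraction⇔ L k l (pred (2 * lam ^ 2))) (ℚᵘ.<-respˡ-≃ (toℚᵘ-/ (ℤ.+ L) (suc k)) (ℚᵘ.<-respʳ-≃ (toℚᵘ-threshold l) (ℚ.toℚᵘ-mono-< h)))))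

load-∷ : ∀ {m k} (t : Subset m) (𝒯 : Vec (Subset m) k) e → load (t ∷ 𝒯) e ≡ 𝟙 (lookup t e) + load 𝒯 e
load-∷ t 𝒯 e rewrite sym (does-∈? e t) with does (e ∈ˢ? t)
... | true  = refl
... | false = refl

≤-by-difference : ∀ {a b} d → a + d ≡ b → a ≤ b
≤-by-difference {a} d refl = m≤m+n a d

-- Min-cuts that are vertices of a contraction

module _ {n m} (G : Multigraph n m) {lam} (minCutValue : Multigraph.IsMinCutValue G lam) where
  open Multigraph G
  open Cuts G

  trivial-min-cut : ∀ {F : Fin m → Set} (X : Fin n → Bool) {x y} → X x ≡ true → X y ≡ false → degree X ≤ lam →
    (∀ {u v} → X u ≡ true → X v ≡ true → Reachable F u v) → (∀ {e} → F e → X (end₁ e) ≡ X (end₂ e)) →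
    ∃[ X ] (IsTrivialCutOfContraction F X × IsMinCut lam X)
  trivial-min-cut {F} X {x} {y} Xx ¬Xy dX≤ connected uncrossed = Xˢ ,
    ( ( ((x , ∈Xˢ⁺ Xx)
        , λ u∈ v → mk⇔ (λ v∈ → connected (∈Xˢ⁻ u∈) (∈Xˢ⁻ v∈))
                       (λ reach → ∈Xˢ⁺ (trans (sym (not-crossed {S = X} uncrossed (proj₂ reach))) (∈Xˢ⁻ u∈))))
      , λ Xˢ≡⊤ → y∉Xˢ (subst (y ∈ˢ_) (sym Xˢ≡⊤) ∈⊤))
    , ((x , ∈Xˢ⁺ Xx) , (y , x∉p⇒x∈∁p y∉Xˢ))
    , trans (degree-tabulate X) (≤-antisym dX≤ (degree≥ minCutValue X Xx ¬Xy)) )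
    where
    Xˢ : Subset n
    Xˢ = tabulate X
    ∈Xˢ⁺ : ∀ {v} → X v ≡ true → v ∈ˢ Xˢ
    ∈Xˢ⁺ {v} Xv = lookup⇒[]= v Xˢ (trans (lookup∘tabulate X v) Xv)
    ∈Xˢ⁻ : ∀ {v} → v ∈ˢ Xˢ → X v ≡ true
    ∈Xˢ⁻ {v} v∈ = trans (sym (lookup∘tabulate X v)) ([]=⇒lookup v∈)
    y∉Xˢ : ¬ (y ∈ˢ Xˢ)
    y∉Xˢ y∈ = contradiction (trans (sym (∈Xˢ⁻ y∈)) ¬Xy) λ ()

-- The case in which every tree crosses every min-cut at least twice

module NoOneRespectingTree {n m k l N : ℕ} .{{_ : NonZero N}} (G : Multigraph n m) (𝒯 : Vec (Subset m) (suc k))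
    (v₀ : Fin n) (minCutValue : Multigraph.IsMinCutValue G (suc l)) (greedy : IsGreedy G 𝒯)
    (m^N≤2^k : m ^ N ≤ 2 ^ suc k) (small : suc (40 * suc l) * (20 * (suc l * suc l)) ≤ N)
    (two-crossings : ∀ {t} → t ∈ 𝒯 → ∀ S {x y} → S x ≡ true → S y ≡ false → Cuts.degree G S ≤ suc l →
                     2 ≤ card (λ e → lookup t e ∧ Cuts.cross G S e))
    where
  open Multigraph G
  open Cuts G
  open Components G
  open Potential G
  open LoadBounds G

  -- Measured in units of 1 / ν, the load 2/λ is 40λ, the threshold is 40λ − 10, and the
  -- critical load p = 40λ − 5 of D lies midway between them.
  lam ν p j K : ℕ
  lam = suc l
  ν = 20 * (lam * lam)
  j = 34 + 40 * l
  p = suc j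
  K = suc k

  instance
    ν≢0 : NonZero ν
    ν≢0 = m*n≢0 20 (lam * lam)

  -- Every tree meets the min-cut twice, so its edges carry total load at least `2 * K`. `H` marks
  -- edges that fall short of the common bound `c` by at least `h`, and these shortfalls accumulate.
  cut-load : ∀ S {x y} → S x ≡ true → S y ≡ false → degree S ≤ lam → (H : Fin m → Bool) (h c : ℕ) →
             (∀ e → cross S e ≡ true → ν * load 𝒯 e + 𝟙 (H e) * h ≤ c) →
             ν * (2 * K) + card (λ e → cross S e ∧ H e) * h ≤ lam * c
  cut-load S Sx Sy dS≤ H h c bound = begin
    ν * (2 * K) + card (λ e → cross S e ∧ H e) * h
      ≤⟨ +-monoˡ-≤ (card (λ e → cross S e ∧ H e) * h) (*-monoʳ-≤ ν (≤-trans (≤-reflexive (*-comm 2 K)) (total 𝒯 (λ t∈ → two-crossings t∈ S Sx Sy dS≤)))) ⟩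
    ν * sum (λ e → 𝟙 (cross S e) * load 𝒯 e) + card (λ e → cross S e ∧ H e) * h
      ≡⟨ cong₂ _+_ (sym (sum-pull ν (𝟙 ∘ cross S) (load 𝒯))) (*-distribʳ-sum h (λ e → 𝟙 (cross S e ∧ H e))) ⟩
    sum (λ e → 𝟙 (cross S e) * (ν * load 𝒯 e)) + sum (λ e → 𝟙 (cross S e ∧ H e) * h)
      ≡⟨ sym (∑-distrib-+ (λ e → 𝟙 (cross S e) * (ν * load 𝒯 e)) (λ e → 𝟙 (cross S e ∧ H e) * h)) ⟩
    sum (λ e → 𝟙 (cross S e) * (ν * load 𝒯 e) + 𝟙 (cross S e ∧ H e) * h)
      ≤⟨ sum-mono-≤ per-edge ⟩
    sum (λ e → 𝟙 (cross S e) * c)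
      ≡⟨ sym (*-distribʳ-sum c (𝟙 ∘ cross S)) ⟩
    degree S * c
      ≤⟨ *-monoˡ-≤ c dS≤ ⟩
    lam * c ∎
    where
    open ≤-Reasoning
    per-edge : ∀ e → 𝟙 (cross S e) * (ν * load 𝒯 e) + 𝟙 (cross S e ∧ H e) * h ≤ 𝟙 (cross S e) * c
    per-edge e with cross S e in Se
    ... | false = z≤n
    ... | true  = ≤-trans (≤-reflexive (cong (_+ 𝟙 (H e) * h) (*-identityˡ (ν * load 𝒯 e)))) (≤-trans (bound e Se) (≤-reflexive (sym (*-identityˡ c))))
    total : ∀ {i} (𝒯′ : Vec (Subset m) i) → (∀ {t} → t ∈ 𝒯′ → 2 ≤ card (λ e → lookup t e ∧ cross S e)) →
            i * 2 ≤ sum (λ e → 𝟙 (cross S e) * load 𝒯′ e)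
    total []       twice = z≤n
    total (t ∷ 𝒯′) twice = ≤-trans (+-mono-≤ (twice (here refl)) (total 𝒯′ (twice ∘ there)))
      (≤-reflexive (trans (sym (∑-distrib-+ (λ e → 𝟙 (lookup t e ∧ cross S e)) (λ e → 𝟙 (cross S e) * load 𝒯′ e))) (sum-cong-≗ add)))
      where
      split : ∀ a b x → 𝟙 (a ∧ b) + 𝟙 b * x ≡ 𝟙 b * (𝟙 a + x)
      split true  true  x = refl
      split true  false x = refl
      split false true  x = refl
      split false false x = refl
      add : ∀ e → 𝟙 (lookup t e ∧ cross S e) + 𝟙 (cross S e) * load 𝒯′ e ≡ 𝟙 (cross S e) * load (t ∷ 𝒯′) e
      add e = trans (split (lookup t e) (cross S e) (load 𝒯′ e)) (cong (𝟙 (cross S e) *_) (sym (load-∷ t 𝒯′ e)))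

  -- The largest critical load in use is `40 * lam`, that is 2/λ, so `small` covers every
  -- application of the load bounds.
  smaller : ∀ q → q ≤ 40 * lam → suc q * ν ≤ N
  smaller q q≤ = ≤-trans (*-monoˡ-≤ ν (s≤s q≤)) small

  -- Every cut has at least λ edges, so the full edge set is optimal at the critical load 2/λ.
  all-loads : ∀ e → ν * load 𝒯 e ≤ (2 + 40 * lam) * K
  all-loads e = load-upper greedy m^N≤2^k {40 * lam} (λ _ → true) (smaller (40 * lam) ≤-refl)
    (all-edges-optimal {ν} {40 * lam} {lam} v₀ (≤-reflexive (eq lam))
      λ { Y (y , Yy , _ , x , _ , ¬Yx) → degree≥ minCutValue Y Yy ¬Yx }) {e} refl
    where
    eq : ∀ x → 2 * (20 * (x * x)) ≡ 40 * x * x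
    eq = solve-∀

  D : Fin m → Bool
  D = proj₁ (optimum ν p)

  D-optimal : ∀ B → objective ν p B ≤ objective ν p D
  D-optimal = proj₂ (optimum ν p)

  D-closed : ∀ {e} → Spans (elements D) e → D e ≡ true
  D-closed = optimum-closed {ν} {p} {D} D-optimal

  D-loads : ∀ {e} → D e ≡ true → ν * load 𝒯 e ≤ (2 + p) * K
  D-loads {e} De = load-upper greedy m^N≤2^k {p} D (smaller p (≤-by-difference 5 (eq l))) (λ B _ → D-optimal B) De
    where
    eq : ∀ l → 35 + 40 * l + 5 ≡ 40 * suc l
    eq = solve-∀

  -- Two crossings of a min-cut require a min-cut with two edges. This makes ν large enough for
  -- `j≤ν` in the lower bound.
  l≥1 : 1 ≤ l
  l≥1 = n≢0⇒n>0 λ l≡0 → let S , x , y , Sx , Sy , dS≤ = minCut minCutValue in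
    <⇒≱ (two-crossings first S Sx Sy dS≤)
        (≤-trans (sum-mono-≤ λ e → 𝟙-mono {lookup t e ∧ cross S e} (proj₂ ∘ ∧-splits {lookup t e}))
                 (≤-trans dS≤ (≤-reflexive (cong suc l≡0))))
    where
    t : Subset m
    t = Vec.head 𝒯
    head∈ : ∀ {i} (𝒯′ : Vec (Subset m) (suc i)) → Vec.head 𝒯′ ∈ 𝒯′
    head∈ (t ∷ _) = here refl
    first : t ∈ 𝒯
    first = head∈ 𝒯

  outer-loads : ∀ {e} → D e ≡ false → j * K ≤ ν * load 𝒯 e + K
  outer-loads ¬De = load-lower greedy m^N≤2^k {j} D j≤ν (≤-trans (*-monoˡ-≤ ν (n≤1+n j)) (smaller j (≤-by-difference 6 (eq′ l)))) (λ B _ → D-optimal B) ¬De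
    where
    j≤ν : j ≤ ν
    j≤ν = quadratic l l≥1
      where
      eq : ∀ i → 34 + 40 * suc i + (20 * i * i + 40 * i + 6) ≡ 20 * (suc (suc i) * suc (suc i))
      eq = solve-∀
      quadratic : ∀ l → 1 ≤ l → 34 + 40 * l ≤ 20 * (suc l * suc l)
      quadratic (suc i) _ = ≤-by-difference (20 * i * i + 40 * i + 6) (eq i)
    eq′ : ∀ l → 34 + 40 * l + 6 ≡ 40 * suc l
    eq′ = solve-∀

  Low : Fin m → Set
  Low = LowLoad 𝒯 lam (nonZero)

  -- The assumed bound is 40λ - 18 units, safely below the threshold 40λ - 10.
  low : ∀ {e} → ν * load 𝒯 e ≤ (22 + 40 * l) * K → Low e
  low {e} h = below-threshold⁺ l (load 𝒯 e) k (*-cancelˡ-< 10 _ _ (begin-strict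
    10 * (2 * (lam * lam) * L + K)       ≡⟨ eq₁ lam L K ⟩
    ν * L + 10 * K                       ≤⟨ +-monoˡ-≤ (10 * K) h ⟩
    (22 + 40 * l) * K + 10 * K           <⟨ m<m+n _ {8 * K} z<s ⟩
    (22 + 40 * l) * K + 10 * K + 8 * K   ≡⟨ eq₂ l K ⟩
    10 * (4 * lam * K)                   ∎))
    where
    open ≤-Reasoning
    L : ℕ
    L = load 𝒯 e
    eq₁ : ∀ lam L K → 10 * (2 * (lam * lam) * L + K) ≡ 20 * (lam * lam) * L + 10 * K
    eq₁ = solve-∀
    eq₂ : ∀ l K → (22 + 40 * l) * K + 10 * K + 8 * K ≡ 10 * (4 * suc l * K)
    eq₂ = solve-∀

  not-low : ∀ {e} → j * K ≤ ν * load 𝒯 e + K → ¬ Low e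
  not-low {e} h lowe = <⇒≱ (*-monoʳ-< 10 (below-threshold⁻ l (load 𝒯 e) k lowe)) (begin
    10 * (4 * lam * K)                   ≤⟨ m≤m+n _ (3 * K) ⟩
    10 * (4 * lam * K) + 3 * K           ≡⟨ eq₂ l K ⟩
    (34 + 40 * l) * K + 9 * K            ≤⟨ +-monoˡ-≤ (9 * K) h ⟩
    ν * L + K + 9 * K                    ≡⟨ eq₁ lam L K ⟩
    10 * (2 * (lam * lam) * L + K)       ∎)
    where
    open ≤-Reasoning
    L : ℕ
    L = load 𝒯 e
    eq₁ : ∀ lam L K → 20 * (lam * lam) * L + K + 9 * K ≡ 10 * (2 * (lam * lam) * L + K)
    eq₁ = solve-∀
    eq₂ : ∀ l K → 10 * (4 * suc l * K) + 3 * K ≡ (34 + 40 * l) * K + 9 * K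
    eq₂ = solve-∀

  -- If all edges were in `D`, each load would be at most 40λ - 3 units, and the λ edges of a
  -- min-cut would fall 3λ units short of the 40λ² that two crossings per tree demand.
  D-disconnected : ¬ (∀ e → D e ≡ true)
  D-disconnected D-full =
    let S , x , y , Sx , Sy , dS≤ = minCut minCutValue
    in <⇒≱ (impossible l K) (≤-trans (m≤m+n _ _) (cut-load S Sx Sy dS≤ (λ _ → false) 0 ((2 + p) * K)
         λ e _ → ≤-trans (≤-reflexive (+-identityʳ _)) (D-loads (D-full e))))
    where
    eq : ∀ l K → suc l * ((37 + 40 * l) * K) + 3 * (suc l * K) ≡ 20 * (suc l * suc l) * (2 * K)
    eq = solve-∀
    impossible : ∀ l K .{{_ : NonZero K}} → suc l * ((37 + 40 * l) * K) < 20 * (suc l * suc l) * (2 * K)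
    impossible l K@(suc _) = <-≤-trans (m<m+n _ {3 * (suc l * K)} z<s) (≤-reflexive (eq l K))

  part-representative : ∃[ r ] (isRoot (elements D) r ≡ true × degree (part (elements D) r) < suc lam)
  part-representative = small-part {ν} {p} {suc lam} {D} v₀ (≤-by-difference (35 * l + 30) (eq l)) D-optimal
    where
    eq : ∀ l → 2 * (20 * (suc l * suc l)) + (35 * l + 30) ≡ (35 + 40 * l) * suc (suc l)
    eq = solve-∀

  r : Fin n
  r = proj₁ part-representative

  X : Fin n → Bool
  X = part (elements D) r

  Xr : X r ≡ true
  Xr = proj₁ (proj₂ part-representative)

  dX≤ : degree X ≤ lam
  dX≤ = s≤s⁻¹ (proj₂ (proj₂ part-representative))

  X⇒label : ∀ {v} → X v ≡ true → label (elements D) v ≡ r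
  X⇒label {v} = does⇒ (label (elements D) v) r

  inner⇒D : ∀ {e} → inner X e ≡ true → D e ≡ true
  inner⇒D {e} in-X = let a , b = ∧-splits {X (end₁ e)} in-X in D-closed (trans (X⇒label a) (sym (X⇒label b)))

  D⇒uncrossed : ∀ {e} → D e ≡ true → X (end₁ e) ≡ X (end₂ e)
  D⇒uncrossed De = cong (λ v → does (v Fin.≟ r)) (spans-member {elements D} (∈-elements⁺ D De))

  X-proper : ∃[ y ] X y ≡ false
  X-proper = decidable-stable (Fin.any? (λ y → X y Bool.≟ false)) λ none →
    let only : ∀ v → label (elements D) v ≡ r
        only v = X⇒label (decidable-stable (X v Bool.≟ true) λ ¬Xv → none (v , not-true ¬Xv))
    in D-disconnected λ e → D-closed (trans (only (end₁ e)) (sym (only (end₂ e))))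

  -- A min-cut Y strictly inside X has at least λ / 2 of its edges inside X, where the
  -- loads are bounded away from 2 / λ, so its total load would be less than 2.
  X-minimal : ∀ Y → ProperPart X Y → suc lam ≤ degree Y
  X-minimal Y (y , Yy , Y⊆X , x , Xx , ¬Yx) = ≰⇒> λ dY≤ → impossible l K g (half dY≤)
    -- Five units separate the bound 40λ + 2 for arbitrary edges from the bound 40λ - 3 for edges of
    -- `D`.
    (cut-load Y Yy ¬Yx dY≤ (inner X) (5 * K) ((2 + 40 * lam) * K) inner-light)
    where
    open ≤-Reasoning
    Z : Fin n → Bool
    Z v = X v ∧ not (Y v)
    g : ℕ
    g = card (λ e → cross Y e ∧ inner X e)
    eq₁ : ∀ l K → (2 + (35 + 40 * l)) * K + 1 * (5 * K) ≡ (2 + 40 * suc l) * K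
    eq₁ = solve-∀
    inner-light : ∀ e → cross Y e ≡ true → ν * load 𝒯 e + 𝟙 (inner X e) * (5 * K) ≤ (2 + 40 * lam) * K
    inner-light e _ = bound (inner X e) refl
      where
      bound : ∀ b → inner X e ≡ b → ν * load 𝒯 e + 𝟙 b * (5 * K) ≤ (2 + 40 * lam) * K
      bound false _    = ≤-trans (≤-reflexive (+-identityʳ _)) (all-loads e)
      bound true  in-X = ≤-trans (+-monoˡ-≤ (1 * (5 * K)) (D-loads (inner⇒D {e} in-X))) (≤-reflexive (eq₁ l K))
    per-edge : ∀ xa ya xb yb → (ya ≡ true → xa ≡ true) → (yb ≡ true → xb ≡ true) →
               𝟙 (ya xor yb) + 𝟙 ((xa ∧ not ya) xor (xb ∧ not yb)) ≤ 𝟙 (xa xor xb) + 2 * 𝟙 ((ya xor yb) ∧ (xa ∧ xb))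
    per-edge false true  _     _     p q = contradiction (p refl) λ ()
    per-edge true  _     false true  p q = contradiction (q refl) λ ()
    per-edge false false false true  p q = contradiction (q refl) λ ()
    per-edge true  true  true  true  p q = ≤-refl
    per-edge true  true  true  false p q = ≤-refl
    per-edge true  true  false false p q = ≤-refl
    per-edge true  false true  true  p q = ≤-refl
    per-edge true  false true  false p q = ≤-refl
    per-edge true  false false false p q = ≤-refl
    per-edge false false true  true  p q = ≤-refl
    per-edge false false true  false p q = ≤-refl
    per-edge false false false false p q = ≤-refl
    -- Edges of `Y` inside `X` are counted by both `Y` and its complement `Z` in `X`, while an edge
    -- leaving `X` is counted by only one of them.
    submodular : degree Y + degree Z ≤ degree X + 2 * g
    submodular = begin
      degree Y + degree Z
        ≡⟨ sym (∑-distrib-+ (𝟙 ∘ cross Y) (𝟙 ∘ cross Z)) ⟩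
      sum (λ e → 𝟙 (cross Y e) + 𝟙 (cross Z e))
        ≤⟨ sum-mono-≤ (λ e → per-edge (X (end₁ e)) (Y (end₁ e)) (X (end₂ e)) (Y (end₂ e)) Y⊆X Y⊆X) ⟩
      sum (λ e → 𝟙 (cross X e) + 2 * 𝟙 (cross Y e ∧ inner X e))
        ≡⟨ ∑-distrib-+ (𝟙 ∘ cross X) (λ e → 2 * 𝟙 (cross Y e ∧ inner X e)) ⟩
      degree X + sum (λ e → 2 * 𝟙 (cross Y e ∧ inner X e))
        ≡⟨ cong (degree X +_) (sym (*-distribˡ-sum 2 (λ e → 𝟙 (cross Y e ∧ inner X e)))) ⟩
      degree X + 2 * g ∎
    half : degree Y ≤ lam → lam ≤ 2 * g
    half dY≤ = +-cancelˡ-≤ lam _ _ (≤-trans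
      (+-mono-≤ (degree≥ minCutValue Y Yy ¬Yx)
                (degree≥ minCutValue Z (cong₂ (λ a b → a ∧ not b) Xx ¬Yx) (trans (cong (λ b → X y ∧ not b) Yy) (Bool.∧-zeroʳ (X y)))))
      (≤-trans submodular (+-monoˡ-≤ (2 * g) dX≤)))
    -- The cut load forces `5 * g ≤ 2 * λ`, whereas `2 * g ≥ λ` gives `5 * g ≥ 5 * λ / 2`.
    impossible : ∀ l K g .{{_ : NonZero K}} → suc l ≤ 2 * g → ¬ (20 * (suc l * suc l) * (2 * K) + g * (5 * K) ≤ suc l * ((2 + 40 * suc l) * K))
    impossible l K@(suc _) g lam≤2g h = <⇒≱ (m<m+n (4 * (suc l * K)) {suc l * K} z<s) (begin
      4 * (suc l * K) + suc l * K      ≡⟨ eq₂ l K ⟩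
      suc l * (5 * K)                  ≤⟨ *-monoˡ-≤ (5 * K) lam≤2g ⟩
      2 * g * (5 * K)                  ≡⟨ *-assoc 2 g (5 * K) ⟩
      2 * (g * (5 * K))                ≤⟨ *-monoʳ-≤ 2 (+-cancelˡ-≤ (20 * (suc l * suc l) * (2 * K)) _ _ (≤-trans h (≤-reflexive (eq₃ l K)))) ⟩
      2 * (2 * (suc l * K))            ≡⟨ eq₄ (suc l * K) ⟩
      4 * (suc l * K)                  ∎)
      where
      eq₂ : ∀ l K → 4 * (suc l * K) + suc l * K ≡ suc l * (5 * K)
      eq₂ = solve-∀
      eq₃ : ∀ l K → suc l * ((2 + 40 * suc l) * K) ≡ 20 * (suc l * suc l) * (2 * K) + 2 * (suc l * K)
      eq₃ = solve-∀
      eq₄ : ∀ x → 2 * (2 * x) ≡ 4 * x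
      eq₄ = solve-∀

  -- The critical load 40λ - 20 is admissible for cuts of size λ + 1, because `(40λ − 20)(λ + 1)`
  -- exceeds `2 * ν` by 20(λ - 1); the two units of error keep the loads below the threshold.
  inner-low : ∀ {e} → inner X e ≡ true → Low e
  inner-low {e} in-X = low (load-upper greedy m^N≤2^k {20 + 40 * l} (inner X) (smaller (20 + 40 * l) (≤-by-difference 20 (eq l)))
    (inner-optimal {ν} {20 + 40 * l} {suc lam} X {r} Xr (≤-by-difference (20 * l) (eq′ l)) (≤-trans dX≤ (n≤1+n lam)) X-minimal) {e} in-X)
    where
    eq : ∀ l → 20 + 40 * l + 20 ≡ 40 * suc l
    eq = solve-∀
    eq′ : ∀ l → 2 * (20 * (suc l * suc l)) + 20 * l ≡ (20 + 40 * l) * suc (suc l)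
    eq′ = solve-∀

  low⇒uncrossed : ∀ {e} → Low e → X (end₁ e) ≡ X (end₂ e)
  low⇒uncrossed {e} lowe = xor-false λ crosses → not-low {e} (outer-loads (not-true λ De →
    contradiction (trans (sym crosses) (trans (cong (_xor X (end₂ e)) (D⇒uncrossed {e} De)) (Bool.xor-same (X (end₂ e))))) λ ())) lowe

  -- No edge of `D` leaves `X`, so the walk stays in `X` and uses inner edges only.
  walk-inside : ∀ {u v ss} → X u ≡ true → Walk (λ e → D e ≡ true) u ss v → Walk Low u ss v
  walk-inside Xu [] = []
  walk-inside Xu (_∷_ {e = e} (De , inj₁ (refl , refl)) ws) = let Xv = trans (sym (D⇒uncrossed De)) Xu in
    (inner-low {e} (cong₂ _∧_ Xu Xv) , inj₁ (refl , refl)) ∷ walk-inside Xv ws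
  walk-inside Xu (_∷_ {e = e} (De , inj₂ (refl , refl)) ws) = let Xv = trans (D⇒uncrossed De) Xu in
    (inner-low {e} (cong₂ _∧_ Xv Xu) , inj₂ (refl , refl)) ∷ walk-inside Xv ws

  X-connected : ∀ {u v} → X u ≡ true → X v ≡ true → Reachable Low u v
  X-connected Xu Xv = let ss , ws = label⇒reachable (elements D) (∈-elements⁻ D) (trans (X⇒label Xu) (sym (X⇒label Xv)))
                      in ss , walk-inside Xu ws

  conclusion : ∃[ X ] (IsTrivialCutOfContraction Low X × IsMinCut lam X)
  conclusion = trivial-min-cut G minCutValue {Low} X Xr (proj₂ X-proper) dX≤ X-connected low⇒uncrossed

-- The case distinction and the constant

∣∩∣≡card : ∀ {m} (s t : Subset m) → ∣ s ∩ t ∣ ≡ card (λ e → lookup s e ∧ lookup t e)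
∣∩∣≡card s t = trans (∣∣≡card (s ∩ t)) (sum-cong-≗ λ e → cong 𝟙 (lookup-zipWith _∧_ e s t))

theorem4 : ∃[ C ] (0 < C ×
    (∀ (n m k : ℕ) .{{_ : NonZero k}}
    (G : Multigraph n m) (lam : ℕ) (𝒯 : Vec (Subset m) k) →
    let open Multigraph G in
    2 ≤ n →
    (connected : Connected) →
    (minCutValue : IsMinCutValue lam) →
    IsGreedy G 𝒯 →
    (C * lam ^ 3) ·log₂ m ≤ k →
    (∃[ T ] (T ∈ 𝒯 × ∃[ S ] (IsMinCut lam S × OneRespects T S)))
    ⊎
    (∃[ X ] (IsTrivialCutOfContraction
    (LowLoad 𝒯 lam (minCutValue-nonZero connected minCutValue)) X
    × IsMinCut lam X))))
-- `820 = 20 * (40 + 1)`: as λ ≥ 1, `N = 820 λ³` is at least `(40λ + 1) * 20λ²`, the bound that the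
-- largest critical load requires.
theorem4 = 820 , z<s , main
  where
  main : (n m k : ℕ) .{{_ : NonZero k}} (G : Multigraph n m) (lam : ℕ) (𝒯 : Vec (Subset m) k) →
    let open Multigraph G in
    2 ≤ n →
    (connected : Connected) →
    (minCutValue : IsMinCutValue lam) →
    IsGreedy G 𝒯 →
    (820 * lam ^ 3) ·log₂ m ≤ k →
    (∃[ T ] (T ∈ 𝒯 × ∃[ S ] (IsMinCut lam S × OneRespects T S)))
    ⊎
    (∃[ X ] (IsTrivialCutOfContraction
    (LowLoad 𝒯 lam (minCutValue-nonZero connected minCutValue)) X
    × IsMinCut lam X))
  main n m k G zero 𝒯 2≤n connected minCutValue greedy many = contradiction refl (≢-nonZero⁻¹ 0 {{Multigraph.minCutValue-nonZero G connected minCutValue}})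
  main (suc n) m (suc k) G (suc l) 𝒯 2≤n connected minCutValue greedy many
    -- The first alternative is a finite search and hence decidable; its failure yields the two
    -- crossings.
    with VecAny.any? (λ t → anySubset? (λ S → (nonempty? S ×-dec nonempty? (∁ S)) ×-dec (∣ Multigraph.crossing G S ∣ ≟ suc l) ×-dec (∣ t ∩ Multigraph.crossing G S ∣ ≤? 1))) 𝒯
  ... | yes found = let t , t∈ , S , isCut , size , respects = find found in inj₁ (t , t∈ , S , (isCut , size) , respects)
  ... | no none = inj₂ (NoOneRespectingTree.conclusion {N = 820 * suc l ^ 3} {{m*n≢0 820 (suc l ^ 3) {{_}} {{m^n≢0 (suc l) 3}}}} G 𝒯 zero minCutValue greedy many
      (≤-by-difference (l * (20 * (suc l * suc l))) (eq l)) two-crossings)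
    where
    open Multigraph G
    open Cuts G
    eq : ∀ l → suc (40 * suc l) * (20 * (suc l * suc l)) + l * (20 * (suc l * suc l)) ≡ 820 * (suc l * (suc l * (suc l * 1)))
    eq = solve-∀
    two-crossings : ∀ {t} → t ∈ 𝒯 → ∀ S {x y} → S x ≡ true → S y ≡ false → degree S ≤ suc l →
                    2 ≤ card (λ e → lookup t e ∧ cross S e)
    two-crossings {t} t∈ S {x} {y} Sx Sy dS≤ = ≰⇒> λ ≤1 → none (VecAny.map (λ { refl → Sˢ ,
        ( ((x , lookup⇒[]= x Sˢ (trans (lookup∘tabulate S x) Sx))
          , (y , x∉p⇒x∈∁p λ y∈ → contradiction (trans (sym ([]=⇒lookup y∈)) (trans (lookup∘tabulate S y) Sy)) λ ()))
        , trans (degree-tabulate S) (≤-antisym dS≤ (degree≥ minCutValue S Sx Sy))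
        , ≤-trans (≤-reflexive tree-degree) ≤1) }) t∈)
      where
      Sˢ : Subset (suc n)
      Sˢ = tabulate S
      tree-degree : ∣ t ∩ crossing Sˢ ∣ ≡ card (λ e → lookup t e ∧ cross S e)
      tree-degree = trans (∣∩∣≡card t (crossing Sˢ)) (sum-cong-≗ λ e → cong (λ b → 𝟙 (lookup t e ∧ b))
        (trans (lookup∘tabulate (cross (lookup Sˢ)) e) (cong₂ _xor_ (lookup∘tabulate S (end₁ e)) (lookup∘tabulate S (end₂ e)))))
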